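{- For $n\ge3$ with $n\equiv2\pmod4$, $$p_n(\Sigma^-_2)=C'(n,2)-C'(\tfrac n2,2)=L_2(n),$$ where $L_2(n)=\frac1n\sum_{d\mid n}\mu(d)2^{n/d}$ and $\mu$ is the Möbius function.
   Context: For $\sigma\in\{+,-\}^k$ ($k\ge2$), let $\mathcal W_k$ be the set of infinite words over $\{0,\dots,k-1\}$ with the linear order $\prec_\sigma$: for $s\neq t$, with $j$ the first index where $s_j\neq t_j$ and $c=|\{i<j:\sigma_{s_i}=-\}|$, $s\prec_\sigma t$ iff ($c$ even and $s_j<t_j$) or ($c$ odd and $s_j>t_j$). The signed shift $\Sigma_\sigma$ deletes the first letter of a word. Let $\mathcal W_{k,n}$ be the set of words $(s_1\dots s_n)^\infty$ with $s_1\dots s_n$ primitive (not a power of a shorter word). For $s\in\mathcal W_{k,n}$ let $\Pi_\sigma(s)\in\mathcal S_n$ be the permutation with $\Pi_\sigma(s)_i<\Pi_\sigma(s)_j$ iff $s_is_{i+1}\dots\prec_\sigma s_js_{j+1}\dots$. Let $\mathcal P_n(\Sigma_\sigma)=\{\Pi_\sigma(s):s\in\mathcal W_{k,n}\}$ and $p_n(\Sigma_\sigma)=|\mathcal P_n(\Sigma_\sigma)|/n$ (the number of classes of $\mathcal P_n(\Sigma_\sigma)$ under cyclic rotation). $\Sigma^-_k$ denotes the reverse $k$-shift $\Sigma_{ -^k}$ (all signs $-$). $C'(n,i)$ denotes the number of cyclic permutations ($n$-cycles) in $\mathcal S_n$ with exactly $i-1$ ascents, an ascent of $\tau$ being an $i\in[n-1]$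 with $\tau_i<\tau_{i+1}$. -}

module Defs where

open import Data.Bool using (Bool; true; false; if_then_else_; _∧_; _∨_; not)
open import Data.Nat as ℕ using (ℕ; zero; suc; _+_; _≤_; _<_; _%_; _/_; _<ᵇ_; _≡ᵇ_)
open import Data.Nat.Divisibility using (_∣?_)
open import Data.Nat.Primality using (prime?)
open import Data.Fin as Fin using (Fin; toℕ)
open import Data.Fin.Properties using (_≟_)
open import Data.Integer as ℤ using (ℤ; +_; -[1+_])
open import Data.List as List using (List; []; _∷_; length; map; filterᵇ; concatMap; upTo; allFin; replicate; concat)
open import Data.Bool.ListAction using (all; any)
open import Data.Vec as Vec using (Vec; lookup; toList)
open import Data.Product using (Σ; ∃; _×_; _,_)
open import Data.Sum using (_⊎_)
open import Relation.Binary.PropositionalEquality using (_≡_)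
open import Relation.Nullary using (¬_; ⌊_⌋)
open import Function.Bundles using (_⇔_)
open import Data.List.Membership.Propositional using (_∈_)
open import Data.List.Relation.Unary.Unique.Propositional using (Unique)

data Sign : Set where
  plus minus : Sign

SignVec : ℕ → Set
SignVec k = Fin k → Sign

reverseSigns : (k : ℕ) → SignVec k
reverseSigns k _ = minus

Word : ℕ → Set
Word k = ℕ → Fin k

isMinus : Sign → Bool
isMinus plus  = false
isMinus minus = true

minusCount : ∀ {k} → SignVec k → Word k → ℕ → ℕ
minusCount σ s zero    = 0
minusCount σ s (suc j) = minusCount σ s j + (if isMinus (σ (s j)) then 1 else 0)

_≺[_]_ : ∀ {k} → Word k → SignVec k → Word k → Set
s ≺[ σ ] t = ∃ λ j → (∀ i → i < j → s i ≡ t i) ×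
  ((minusCount σ s j % 2 ≡ 0 × toℕ (s j) < toℕ (t j)) ⊎
   (minusCount σ s j % 2 ≡ 1 × toℕ (t j) < toℕ (s j)))

shiftBy : ∀ {k} → ℕ → Word k → Word k
shiftBy i s m = s (i + m)

prefix : ∀ {k} → (n : ℕ) → Word k → List (Fin k)
prefix n s = List.tabulate {n = n} (λ i → s (toℕ i))

Primitive : ∀ {k} → List (Fin k) → Set
Primitive u = ¬ (Σ (List _) λ v → Σ ℕ λ r → 2 ≤ r × u ≡ concat (replicate r v))

InW : (k n : ℕ) → Word k → Set
InW k n s = (∀ m → s (n + m) ≡ s m) × Primitive (prefix n s)

-- permutations of S_n in one-line notation (0-based values)
IsPerm : ∀ {n} → Vec (Fin n) n → Set
IsPerm {n} π = ∀ (i j : Fin n) → lookup π i ≡ lookup π j → i ≡ j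

IsPattern : ∀ {k n} → SignVec k → Word k → Vec (Fin n) n → Set
IsPattern {n = n} σ s π = IsPerm π ×
  (∀ (i j : Fin n) → (lookup π i Fin.< lookup π j) ⇔ (shiftBy (toℕ i) s ≺[ σ ] shiftBy (toℕ j) s))

InP : ∀ {k} → SignVec k → (n : ℕ) → Vec (Fin n) n → Set
InP {k} σ n π = Σ (Word k) λ s → InW k n s × IsPattern σ s π

Enumerates : ∀ {A : Set} → (A → Set) → List A → Set
Enumerates P L = Unique L × (∀ x → (x ∈ L) ⇔ P x)

allVecs : (k n : ℕ) → List (Vec (Fin k) n)
allVecs k zero    = Vec.[] ∷ []
allVecs k (suc n) = concatMap (λ x → map (x Vec.∷_) (allVecs k n)) (allFin k)

isPermᵇ : ∀ {n} → Vec (Fin n) n → Bool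
isPermᵇ {n} π = all (λ i → all (λ j → ⌊ i ≟ j ⌋ ∨ not ⌊ lookup π i ≟ lookup π j ⌋) (allFin n)) (allFin n)

iter : ∀ {n} → Vec (Fin n) n → ℕ → Fin n → Fin n
iter π zero    x = x
iter π (suc j) x = lookup π (iter π j x)

isCyclicᵇ : ∀ {n} → Vec (Fin n) n → Bool
isCyclicᵇ {n} π = all (λ x → all (λ y → any (λ j → ⌊ iter π j x ≟ y ⌋) (upTo n)) (allFin n)) (allFin n)

ascentsList : List ℕ → ℕ
ascentsList (a ∷ b ∷ r) = (if a <ᵇ b then 1 else 0) + ascentsList (b ∷ r)
ascentsList _ = 0

ascents : ∀ {n} → Vec (Fin n) n → ℕ
ascents π = ascentsList (map toℕ (toList π))

C′ : ℕ → ℕ → ℕ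
C′ n i = length (filterᵇ (λ π → isPermᵇ π ∧ isCyclicᵇ π ∧ (ascents π ≡ᵇ ℕ.pred i)) (allVecs n n))

primesUpTo : ℕ → List ℕ
primesUpTo d = filterᵇ (λ p → ⌊ prime? p ⌋) (upTo (suc d))

μ : ℕ → ℤ
μ d = if any (λ p → ⌊ (p ℕ.* p) ∣? d ⌋) (primesUpTo d) then + 0
      else (if length (filterᵇ (λ p → ⌊ p ∣? d ⌋) (primesUpTo d)) % 2 ≡ᵇ 0 then + 1 else -[1+ 0 ])

-- n · L_2(n) = Σ_{d ∣ n, d ≥ 1} μ(d) 2^{n/d}   (d = suc e ranges over 1..n)
nL₂ : (n : ℕ) → ℤ
nL₂ n = List.foldr ℤ._+_ (+ 0)
  (List.map (λ e → μ (suc e) ℤ.* + (2 ℕ.^ (n ℕ./ suc e)))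
    (filterᵇ (λ e → ⌊ suc e ∣? n ⌋) (upTo n)))

{-# OPTIONS --safe #-}
-- A word s and a permutation π are compatible if π sorts the positions of the periodic word
-- by their letters and, among positions with equal letters, shifting by one reverses the order.
-- A cyclic permutation with one ascent together with a starting point is the same thing as a
-- permutation π compatible with some word, and for n ≥ 3 that word is unique.  Conversely, a
-- primitive word has exactly one compatible permutation, namely its pattern.  An even period of a
-- compatible word acts monotonically on a cycle, hence trivially, so the only other compatible
-- words of length n are squares of primitive words of odd length n / 2.  These have two compatible
-- permutations each, since the order of one pair of equal shifts decides that of all others.
-- So n C′(n,2) = P(n) + 2 P(n/2), where P(n) is the number of patterns and of primitive words
-- of length n, and (n/2) C′(n/2,2) = P(n/2).  Finally P(n) = n L₂(n) by Möbius inversion.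
module Submission where

open import Defs
open import Data.Bool using (Bool; true; false; T; if_then_else_; _∧_; _∨_; not)
open import Data.Bool.Properties using (T-∧; T?)
open import Data.Bool.ListAction using (all; any)
open import Data.Empty using (⊥; ⊥-elim)
open import Data.Fin as Fin using (Fin; toℕ; fromℕ<)
import Data.Fin.Properties as FinP
open import Data.Integer as ℤ using (ℤ)
import Data.Integer.Properties as ℤP
open import Data.List as List using (List; []; _∷_; _++_; length; map; filter; filterᵇ; concat; concatMap; replicate; upTo; allFin; cartesianProduct; cartesianProductWith)
import Data.List.Properties as ListP
open import Data.List.Membership.Propositional using (_∈_; find; lose)
open import Data.List.Membership.Propositional.Properties
open import Data.List.Membership.Propositional.Properties.WithK using (unique∧set⇒bag)
open import Data.List.Relation.Binary.BagAndSetEquality using (∼bag⇒↭)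
open import Data.List.Relation.Binary.Permutation.Propositional.Properties using (↭-length)
open import Data.List.Relation.Unary.All as All using (All; []; _∷_)
import Data.List.Relation.Unary.All.Properties as AllP
open import Data.List.Relation.Unary.AllPairs using ([]; _∷_)
open import Data.List.Relation.Unary.Any as Any using (here; there)
import Data.List.Relation.Unary.Any.Properties as AnyP
open import Data.List.Relation.Unary.Unique.Propositional using (Unique)
import Data.List.Relation.Unary.Unique.Propositional.Properties as UniqueP
open import Data.Nat as ℕ using (ℕ; zero; suc; pred; _+_; _*_; _∸_; _^_; _≤_; _<_; _%_; _/_; _≡ᵇ_; _<ᵇ_; z≤n; s≤s; NonZero)
open import Data.Nat.DivMod
open import Data.Nat.Divisibility
open import Data.Nat.Induction using (<-rec)
open import Data.Nat.GCD using (module GCD; module Bézout)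
open import Data.Nat.Primality
open import Data.Nat.Primality.Factorisation using (factorise)
import Data.Nat.Properties as ℕP
open import Data.Product using (Σ; ∃; _×_; _,_; proj₁; proj₂)
open import Data.Sum as Sum using (_⊎_; inj₁; inj₂)
open import Data.Unit using (⊤; tt)
open import Data.Vec as Vec using (Vec; lookup; toList)
import Data.Vec.Properties as VecP
open import Function using (_∘_; id; it; _⇔_; mk⇔; Equivalence)
open import Relation.Binary.Definitions using (tri<; tri≈; tri>)
open import Relation.Binary.PropositionalEquality using (_≡_; _≢_; refl; sym; trans; cong; cong₂; subst; subst₂; module ≡-Reasoning)
open import Relation.Nullary using (¬_; Dec; yes; no; contradiction; ⌊_⌋; _×-dec_; _→-dec_; ¬?)
open import Relation.Nullary.Decidable using (toWitness; fromWitness; map′; decidable-stable)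

-- Cardinality of predicates

-- Uniqueness of the word rests on two reversals composing to an order-preserving shift: if the
-- shift by one reversed all ranks, the shift by 2 would be monotone on a cycle, hence trivial, and
-- `n` would divide 2. The bound `3 ≤ n` excludes this, and it excludes it for `n / 2` as well,
-- because `n ≡ 2` modulo 4 then leaves `n ≥ 6`. That a square of length `n = 2 m` carries two
-- orderings is a matter of parity. Passing from the tied pair `(i, m + i)` to `(m + i, 2 m + i)`
-- takes `m` reversals, and the second pair is the first with its entries exchanged. An odd number
-- of reversals is therefore consistent with either choice, an even number with neither. Existence
-- of a compatible permutation needs a construction: the comparison of infinite shifts is replaced
-- by the comparison of finite numbers (`key`), whose ranks form the permutation. Hence
-- compatibility is stated for arbitrary `ℕ`-valued functions. Words and permutations are unrolled
-- to periodic sequences on `ℕ`, so that shifting is addition of indices.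

Card : {A : Set} → (A → Set) → ℕ → Set
Card P k = Σ (List _) λ L → Enumerates P L × length L ≡ k

length-cartesianProductWith : {A B C : Set} (f : A → B → C) (xs : List A) (ys : List B) →
  length (cartesianProductWith f xs ys) ≡ length xs * length ys
length-cartesianProductWith f []       ys = refl
length-cartesianProductWith f (x ∷ xs) ys =
  trans (ListP.length-++ (map (f x) ys))
    (cong₂ _+_ (ListP.length-map (f x) ys) (length-cartesianProductWith f xs ys))

module _ {A : Set} where

  Unique-map : {B : Set} (f : A → B) (L : List A) →
    (∀ {x y} → x ∈ L → y ∈ L → f x ≡ f y → x ≡ y) → Unique L → Unique (map f L)
  Unique-map f []      inj []        = []
  Unique-map f (x ∷ L) inj (x∉ ∷ uL) =
    AllP.map⁺ (All.tabulate λ y∈ eq → All.lookup x∉ y∈ (inj (here refl) (there y∈) eq))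
    ∷ Unique-map f L (λ p q → inj (there p) (there q)) uL

  card-unique : {P : A → Set} {k l : ℕ} → Card P k → Card P l → k ≡ l
  card-unique (L , (uL , eL) , refl) (M , (uM , eM) , refl) =
    ↭-length (∼bag⇒↭ (unique∧set⇒bag uL uM λ {x} →
      mk⇔ (from (eM x) ∘ to (eL x)) (from (eL x) ∘ to (eM x))))
    where open Equivalence

  -- The way a predicate over infinite words, such as `InP`, obtains a size: the enumeration is
  -- transported from a decidable predicate on vectors, so `Q` itself is never decided.
  card-bijection : {B : Set} {P : A → Set} {Q : B → Set} {k : ℕ} (f : A → B) →
    (∀ x → P x → Q (f x)) →
    (∀ x y → P x → P y → f x ≡ f y → x ≡ y) →
    (∀ y → Q y → ∃ λ x → P x × f x ≡ y) →
    Card P k → Card Q k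
  card-bijection {Q = Q} f pres inj surj (L , (uL , eL) , refl) =
    map f L ,
    (Unique-map f L (λ p q → inj _ _ (to (eL _) p) (to (eL _) q)) uL ,
     λ y → mk⇔ (into y) (outof y)) ,
    ListP.length-map f L
    where
    open Equivalence
    into : ∀ y → y ∈ map f L → Q y
    into y y∈ with x , x∈ , refl ← ∈-map⁻ f y∈ = pres x (to (eL x) x∈)
    outof : ∀ y → Q y → y ∈ map f L
    outof y qy with x , px , refl ← surj y qy = ∈-map⁺ f (from (eL x) px)

  card-×Fin : {P : A → Set} {k : ℕ} (n : ℕ) → Card P k → Card (λ (y : A × Fin n) → P (proj₁ y)) (k * n)
  card-×Fin n (L , (uL , eL) , refl) =
    cartesianProduct L (allFin n) ,
    (UniqueP.cartesianProduct⁺ uL (UniqueP.allFin⁺ n) ,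
     λ y → mk⇔ (λ y∈ → to (eL _) (proj₁ (∈-cartesianProduct⁻ L (allFin n) y∈)))
               (λ py → ∈-cartesianProduct⁺ (from (eL _) py) (∈-allFin (proj₂ y)))) ,
    trans (length-cartesianProductWith _,_ L (allFin n))
      (cong (length L *_) (ListP.length-tabulate id))
    where open Equivalence

  card-⊎ : {B : Set} {P : A → Set} {Q : B → Set} {k l : ℕ} →
    Card P k → Card Q l → Card Sum.[ P , Q ] (k + l)
  card-⊎ {B} {P} {Q} (L , (uL , eL) , refl) (M , (uM , eM) , refl) =
    map inj₁ L ++ map inj₂ M ,
    (UniqueP.++⁺ (UniqueP.map⁺ (λ { refl → refl }) uL) (UniqueP.map⁺ (λ { refl → refl }) uM) disj ,
     λ y → mk⇔ (into y) (outof y)) ,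
    trans (ListP.length-++ (map inj₁ L)) (cong₂ _+_ (ListP.length-map inj₁ L) (ListP.length-map inj₂ M))
    where
    open Equivalence
    disj : ∀ {v} → (v ∈ map inj₁ L) × (v ∈ map inj₂ M) → ⊥
    disj (p , q) with _ , _ , refl ← ∈-map⁻ inj₁ p with _ , _ , () ← ∈-map⁻ inj₂ q
    into : ∀ y → y ∈ map inj₁ L ++ map inj₂ M → Sum.[ P , Q ] y
    into y y∈ with ∈-++⁻ (map inj₁ L) y∈
    ... | inj₁ p with x , x∈ , refl ← ∈-map⁻ inj₁ p = to (eL x) x∈
    ... | inj₂ p with x , x∈ , refl ← ∈-map⁻ inj₂ p = to (eM x) x∈
    outof : ∀ y → Sum.[ P , Q ] y → y ∈ map inj₁ L ++ map inj₂ M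
    outof (inj₁ x) px = ∈-++⁺ˡ (∈-map⁺ inj₁ (from (eL x) px))
    outof (inj₂ x) qx = ∈-++⁺ʳ (map inj₁ L) (∈-map⁺ inj₂ (from (eM x) qx))

  card-filter : {P : A → Set} (P? : ∀ x → Dec (P x)) {L : List A} →
    Enumerates (λ _ → ⊤) L → Card P (length (filter P? L))
  card-filter P? {L} (uL , eL) =
    filter P? L ,
    (UniqueP.filter⁺ P? uL ,
     λ x → mk⇔ (proj₂ ∘ ∈-filter⁻ P? {xs = L}) (∈-filter⁺ P? (Equivalence.from (eL x) tt))) ,
    refl

concatMap-map : {A B C : Set} (f : A → B → C) (xs : List A) (ys : List B) →
  concatMap (λ x → map (f x) ys) xs ≡ cartesianProductWith f xs ys
concatMap-map f []       ys = refl
concatMap-map f (x ∷ xs) ys = cong (map (f x) ys ++_) (concatMap-map f xs ys)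

allVecs-enumerates : ∀ k n → Enumerates (λ _ → ⊤) (allVecs k n)
allVecs-enumerates k zero = ([] ∷ []) , λ { Vec.[] → mk⇔ _ (λ _ → here refl) }
allVecs-enumerates k (suc n)
  rewrite concatMap-map (Vec._∷_ {n = n}) (allFin k) (allVecs k n) =
    UniqueP.cartesianProductWith⁺ Vec._∷_ (λ { refl → refl , refl }) (UniqueP.allFin⁺ k) (proj₁ IH) ,
    λ { (x Vec.∷ v) → mk⇔ _ λ _ →
      ∈-cartesianProductWith⁺ Vec._∷_ (∈-allFin x) (Equivalence.from (proj₂ IH v) tt) }
  where IH = allVecs-enumerates k n

length-allVecs : ∀ k n → length (allVecs k n) ≡ k ^ n
length-allVecs k zero = refl
length-allVecs k (suc n) = begin
  length (concatMap (λ x → map (x Vec.∷_) (allVecs k n)) (allFin k))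
    ≡⟨ cong length (concatMap-map Vec._∷_ (allFin k) (allVecs k n)) ⟩
  length (cartesianProductWith Vec._∷_ (allFin k) (allVecs k n))
    ≡⟨ length-cartesianProductWith Vec._∷_ (allFin k) (allVecs k n) ⟩
  length (allFin k) * length (allVecs k n)
    ≡⟨ cong₂ _*_ (ListP.length-tabulate {n = k} id) (length-allVecs k n) ⟩
  k * k ^ n ∎
  where open ≡-Reasoning

-- Periodic sequences

Period : {A : Set} → ℕ → (ℕ → A) → Set
Period p g = ∀ i → g (p + i) ≡ g i

module _ {A : Set} {g : ℕ → A} where

  period-* : ∀ {p} k → Period p g → Period (k * p) g
  period-* zero        per i = refl
  period-* {p} (suc k) per i =
    trans (cong g (ℕP.+-assoc p (k * p) i)) (trans (per (k * p + i)) (period-* k per i))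

  period-∣ : ∀ {p m} → p ∣ m → Period p g → Period m g
  period-∣ (divides k refl) = period-* k

  period-cancelˡ : ∀ {p} m → Period (m + p) g → Period m g → Period p g
  period-cancelˡ {p} m perm+p perm i =
    trans (sym (perm (p + i))) (trans (cong g (sym (ℕP.+-assoc m p i))) (perm+p i))

  period-shift : ∀ {p} j → Period p g → Period p (λ i → g (i + j))
  period-shift {p} j per i = trans (cong g (ℕP.+-assoc p i j)) (per (i + j))

  -- Bézout gives `d` plus a multiple of one period as a multiple of the other. Cancelling the
  -- former leaves `d`, without any negative index.
  period-gcd : ∀ {m n d} → GCD.GCD m n d → Period m g → Period n g → Period d g
  period-gcd gcd perm pern with Bézout.identity gcd
  ... | Bézout.+- x y eq = period-cancelˡ _ (subst (λ t → Period t g) (trans (sym eq) (ℕP.+-comm _ (y * _))) (period-* x perm)) (period-* y pern)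
  ... | Bézout.-+ x y eq = period-cancelˡ _ (subst (λ t → Period t g) (trans (sym eq) (ℕP.+-comm _ (x * _))) (period-* y pern)) (period-* x perm)

  period-% : ∀ {n} .{{_ : NonZero n}} → Period n g → ∀ i → g i ≡ g (i % n)
  period-% {n} per i = begin
    g i                          ≡⟨ cong g (trans (m≡m%n+[m/n]*n i n) (ℕP.+-comm (i % n) _)) ⟩
    g ((i / n) * n + i % n)      ≡⟨ period-* (i / n) per (i % n) ⟩
    g (i % n)                    ∎
    where open ≡-Reasoning

  period-cong : ∀ {n} .{{_ : NonZero n}} → Period n g → ∀ {i j} → i % n ≡ j % n → g i ≡ g j
  period-cong per {i} {j} eq = trans (period-% per i) (trans (cong g eq) (sym (period-% per j)))

periodic-ext : {A : Set} {g h : ℕ → A} {n : ℕ} .{{_ : NonZero n}} → Period n g → Period n h →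
  (∀ i → i < n → g i ≡ h i) → ∀ i → g i ≡ h i
periodic-ext {n = n} perg perh eq i =
  trans (period-% perg i) (trans (eq (i % n) (m%n<n i n)) (sym (period-% perh i)))

suc-%-cong : ∀ {n} .{{_ : NonZero n}} i j → i % n ≡ j % n → suc i % n ≡ suc j % n
suc-%-cong {n} i j eq = begin
  suc i % n              ≡⟨ %-distribˡ-+ 1 i n ⟩
  (1 % n + i % n) % n    ≡⟨ cong (λ t → (1 % n + t) % n) eq ⟩
  (1 % n + j % n) % n    ≡⟨ sym (%-distribˡ-+ 1 j n) ⟩
  suc j % n              ∎
  where open ≡-Reasoning

%-pred : ∀ {n} .{{_ : NonZero n}} i j → suc i % n ≡ suc j % n → i % n ≡ j % n
%-pred {n} i j eq = begin
  i % n                                ≡⟨ sym (%-remove-+ˡ i ∣-refl) ⟩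
  (n + i) % n                          ≡⟨ cong (_% n) (expand i) ⟩
  (pred n + suc i) % n                 ≡⟨ %-distribˡ-+ (pred n) (suc i) n ⟩
  (pred n % n + suc i % n) % n         ≡⟨ cong (λ t → (pred n % n + t) % n) eq ⟩
  (pred n % n + suc j % n) % n         ≡⟨ sym (%-distribˡ-+ (pred n) (suc j) n) ⟩
  (pred n + suc j) % n                 ≡⟨ cong (_% n) (sym (expand j)) ⟩
  (n + j) % n                          ≡⟨ %-remove-+ˡ j ∣-refl ⟩
  j % n                                ∎
  where
  open ≡-Reasoning
  expand : ∀ i → n + i ≡ pred n + suc i
  expand i = trans (cong (_+ i) (sym (ℕP.suc-pred n))) (sym (ℕP.+-suc (pred n) i))

cyc : {A : Set} {n : ℕ} .{{_ : NonZero n}} → Vec A n → ℕ → A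
cyc {n = n} v i = lookup v (i mod n)

module _ {n : ℕ} .{{_ : NonZero n}} where

  mod-cong : ∀ {i j} → i % n ≡ j % n → i mod n ≡ j mod n
  mod-cong {i} {j} eq = FinP.fromℕ<-cong (i % n) (j % n) eq (m%n<n i n) (m%n<n j n)

  toℕ-mod : ∀ i → toℕ (i mod n) ≡ i % n
  toℕ-mod i = FinP.toℕ-fromℕ< (m%n<n i n)

  mod-toℕ : ∀ (i : Fin n) → toℕ i mod n ≡ i
  mod-toℕ i = FinP.toℕ-injective (trans (toℕ-mod (toℕ i)) (m<n⇒m%n≡m (FinP.toℕ<n i)))

module _ {A : Set} {n : ℕ} .{{_ : NonZero n}} where

  cyc-period : (v : Vec A n) → Period n (cyc v)
  cyc-period v i = cong (lookup v) (mod-cong (trans (cong (_% n) (ℕP.+-comm n i)) ([m+n]%n≡m%n i n)))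

  cyc-toℕ : (v : Vec A n) (i : Fin n) → cyc v (toℕ i) ≡ lookup v i
  cyc-toℕ v i = cong (lookup v) (mod-toℕ i)

  cyc-injective : (v w : Vec A n) → (∀ i → cyc v i ≡ cyc w i) → v ≡ w
  cyc-injective v w eq = begin
    v                            ≡⟨ sym (VecP.tabulate∘lookup v) ⟩
    Vec.tabulate (lookup v)      ≡⟨ VecP.tabulate-cong (λ i → trans (sym (cyc-toℕ v i)) (trans (eq (toℕ i)) (cyc-toℕ w i))) ⟩
    Vec.tabulate (lookup w)      ≡⟨ VecP.tabulate∘lookup w ⟩
    w                            ∎
    where open ≡-Reasoning

  cyc-tabulate : (g : ℕ → A) → Period n g → ∀ i → cyc (Vec.tabulate {n = n} (g ∘ toℕ)) i ≡ g i
  cyc-tabulate g per i = begin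
    lookup (Vec.tabulate (g ∘ toℕ)) (i mod n)   ≡⟨ VecP.lookup∘tabulate (g ∘ toℕ) (i mod n) ⟩
    g (toℕ (i mod n))                           ≡⟨ cong g (toℕ-mod i) ⟩
    g (i % n)                                   ≡⟨ sym (period-% per i) ⟩
    g i                                         ∎
    where open ≡-Reasoning

-- Primitive binary words

Fin2-<-bounds : {a b : Fin 2} → a Fin.< b → a ≡ Fin.zero × b ≡ Fin.suc Fin.zero
Fin2-<-bounds {Fin.zero}         {Fin.zero}         ()
Fin2-<-bounds {Fin.zero}         {Fin.suc Fin.zero} _ = refl , refl
Fin2-<-bounds {Fin.suc Fin.zero} {Fin.zero}         ()
Fin2-<-bounds {Fin.suc Fin.zero} {Fin.suc Fin.zero} (s≤s ())

-- Primitivity in the form in which orbit arguments deliver it, as divisibility. The trivial period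
-- 0 is harmless, since everything divides it. Agreement with the notion of not being a proper power
-- is shown in `prim⇒InW` and `InW⇒prim`.
Prim : ℕ → (ℕ → Fin 2) → Set
Prim n s = Period n s × (∀ p → Period p s → n ∣ p)

period? : ∀ {n} .{{_ : NonZero n}} {s : ℕ → Fin 2} → Period n s → ∀ p → Dec (Period p s)
period? {n} {s} per p = map′ ext (λ perp {i} _ → perp i) (ℕP.allUpTo? (λ i → s (p + i) FinP.≟ s i) n)
  where
  ext : (∀ {i} → i < n → s (p + i) ≡ s i) → Period p s
  ext eq = periodic-ext
    (λ i → trans (cong s (trans (sym (ℕP.+-assoc p n i)) (trans (cong (_+ i) (ℕP.+-comm p n)) (ℕP.+-assoc n p i)))) (per (p + i)))
    per (λ i → eq)

Tie : (ℕ → Fin 2) → ℕ → ℕ → Set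
Tie s i j = ∀ d → s (d + i) ≡ s (d + j)

-- A tie speaks only of positions from `i` on. An arbitrary `x` is first moved past `i` by adding
-- `i * n`, a multiple of the period that is at least `i`.
tie⇒period : ∀ {n} .{{_ : NonZero n}} {s} → Period n s → ∀ i p → Tie s i (p + i) → Period p s
tie⇒period {n} {s} per i p tie x = begin
  s (p + x)                     ≡⟨ sym (period-* i per (p + x)) ⟩
  s (i * n + (p + x))           ≡⟨ cong s (eq₁ (i * n) n≤) ⟩
  s ((x + (i * n ∸ i)) + (p + i)) ≡⟨ sym (tie (x + (i * n ∸ i))) ⟩
  s ((x + (i * n ∸ i)) + i)     ≡⟨ cong s (eq₂ (i * n) n≤) ⟩
  s (i * n + x)                 ≡⟨ period-* i per x ⟩
  s x                           ∎
  where
  open ≡-Reasoning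
  n≤ : i ≤ i * n
  n≤ = ℕP.m≤m*n i n
  eq₂ : ∀ N → i ≤ N → (x + (N ∸ i)) + i ≡ N + x
  eq₂ N le = trans (ℕP.+-assoc x (N ∸ i) i) (trans (cong (x +_) (ℕP.m∸n+n≡m le)) (ℕP.+-comm x N))
  eq₁ : ∀ N → i ≤ N → N + (p + x) ≡ (x + (N ∸ i)) + (p + i)
  eq₁ N le = sym (begin
    (x + (N ∸ i)) + (p + i)   ≡⟨ cong ((x + (N ∸ i)) +_) (ℕP.+-comm p i) ⟩
    (x + (N ∸ i)) + (i + p)   ≡⟨ sym (ℕP.+-assoc (x + (N ∸ i)) i p) ⟩
    (x + (N ∸ i)) + i + p     ≡⟨ cong (_+ p) (eq₂ N le) ⟩
    N + x + p                 ≡⟨ ℕP.+-assoc N x p ⟩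
    N + (x + p)               ≡⟨ cong (N +_) (ℕP.+-comm x p) ⟩
    N + (p + x)               ∎)

even-or-odd : ∀ c → (∃ λ h → c ≡ h * 2) ⊎ (∃ λ h → c ≡ 1 + h * 2)
even-or-odd zero = inj₁ (0 , refl)
even-or-odd (suc c) with even-or-odd c
... | inj₁ (h , refl) = inj₂ (h , refl)
... | inj₂ (h , refl) = inj₁ (suc h , refl)

-- Cyclic orderings compatible with a word

-- The values need not fill an interval: both the entries of a permutation and the numbers built by
-- `key` are instances, and only their order is used.
record Cyclic (n : ℕ) .{{_ : NonZero n}} (q : ℕ → ℕ) : Set where
  field
    period    : Period n q
    injective : ∀ i j → q i ≡ q j → i % n ≡ j % n

-- q i plays the role of the rank of the i-th shift of s among all its shifts.
record Compatible (s : ℕ → Fin 2) (q : ℕ → ℕ) : Set where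
  field
    letters  : ∀ i j → s i Fin.< s j → q i < q j
    reverses : ∀ i j → s i ≡ s j → q i < q j → q (suc j) < q (suc i)

open Cyclic
open Compatible

chain : (R : ℕ → ℕ → Set) → (∀ {x y z} → R x y → R y z → R x z) → (a : ℕ → ℕ) →
  (∀ k → R (a k) (a (suc k)) → R (a (suc k)) (a (suc (suc k)))) →
  R (a 0) (a 1) → ∀ k → R (a 0) (a (suc k))
chain R R-trans a step base zero    = base
chain R R-trans a step base (suc k) = R-trans (chain R R-trans a step base k) (link (suc k))
  where
  link : ∀ k → R (a k) (a (suc k))
  link zero    = base
  link (suc k) = step k (link k)

module _ {n : ℕ} .{{_ : NonZero n}} {q : ℕ → ℕ} (C : Cyclic n q) where

  cyclic-suc-cong : ∀ i j → q i ≡ q j → q (suc i) ≡ q (suc j)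
  cyclic-suc-cong i j eq = period-cong (period C) (suc-%-cong i j (injective C i j eq))

  monotone-orbit : (R : ℕ → ℕ → Set) → (∀ {x y z} → R x y → R y z → R x z) → ∀ P →
    (∀ i → R (q i) (q (P + i)) → R (q (P + i)) (q (P + (P + i)))) → R (q 0) (q P) → R (q 0) (q 0)
  monotone-orbit R R-trans P step base =
    subst (R (q 0)) (begin
      q (suc (pred n) * P)   ≡⟨ cong (λ t → q (t * P)) (ℕP.suc-pred n) ⟩
      q (n * P)              ≡⟨ cong q (trans (ℕP.*-comm n P) (sym (ℕP.+-identityʳ (P * n)))) ⟩
      q (P * n + 0)          ≡⟨ period-* P (period C) 0 ⟩
      q 0                    ∎)
      (chain R R-trans (λ k → q (k * P)) (λ k → step (k * P))
        (subst (λ t → R (q 0) (q t)) (sym (ℕP.+-identityʳ P)) base) (pred n))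
    where open ≡-Reasoning

  -- An order preserving shift fixes every point: otherwise its orbits would be
  -- strictly monotone and yet return to their start.
  monotone-shift⇒∣ : ∀ P →
    (∀ i → q i < q (P + i) → q (P + i) < q (P + (P + i))) →
    (∀ i → q (P + i) < q i → q (P + (P + i)) < q (P + i)) → n ∣ P
  monotone-shift⇒∣ P up down with ℕP.<-cmp (q 0) (q P)
  ... | tri≈ _ eq _ = m%n≡0⇒n∣m P n (trans (sym (injective C 0 P eq)) (m*n%n≡0 0 n))
  ... | tri< lt _ _ = contradiction (monotone-orbit _<_ ℕP.<-trans P up lt) (ℕP.<-irrefl refl)
  ... | tri> _ _ gt = contradiction
    (monotone-orbit (λ x y → y < x) (λ y<x z<y → ℕP.<-trans z<y y<x) P down gt) (ℕP.<-irrefl refl)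

  -- Two reversals compose to an order-preserving shift by 2. This is the source of the bound
  -- `3 ≤ n`.
  decreasing⇒∣2 : (∀ i j → q i < q j → q (suc j) < q (suc i)) → n ∣ 2
  decreasing⇒∣2 dec = monotone-shift⇒∣ 2
    (λ i lt → dec (suc (2 + i)) (suc i) (dec i (2 + i) lt))
    (λ i lt → dec (suc i) (suc (2 + i)) (dec (2 + i) i lt))

  -- If s i < s′ i, then s is constant on the ranks up to q i and s′ on those from q i on,
  -- so the ordering is reversed by the shift everywhere.
  compatible-word-< : ∀ {s s′} → Compatible s q → Compatible s′ q → ∀ i → s i Fin.< s′ i → n ∣ 2
  compatible-word-< {s} {s′} c c′ i lt = decreasing⇒∣2 dec
    where
    below : ∀ j → q j ≤ q i → s j ≡ Fin.zero
    below j le with s j in eq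
    ... | Fin.zero = refl
    ... | Fin.suc Fin.zero = contradiction
      (letters c i j (subst₂ Fin._<_ (sym (proj₁ (Fin2-<-bounds lt))) (sym eq) (s≤s z≤n))) (ℕP.≤⇒≯ le)
    above : ∀ j → q i ≤ q j → s′ j ≡ Fin.suc Fin.zero
    above j le with s′ j in eq
    ... | Fin.suc Fin.zero = refl
    ... | Fin.zero = contradiction
      (letters c′ j i (subst₂ Fin._<_ (sym eq) (sym (proj₂ (Fin2-<-bounds lt))) (s≤s z≤n))) (ℕP.≤⇒≯ le)
    dec-below : ∀ j k → q j < q k → q k ≤ q i → q (suc k) < q (suc j)
    dec-below j k j<k k≤i = reverses c j k
      (trans (below j (ℕP.≤-trans (ℕP.<⇒≤ j<k) k≤i)) (sym (below k k≤i))) j<k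
    dec-above : ∀ j k → q j < q k → q i ≤ q j → q (suc k) < q (suc j)
    dec-above j k j<k i≤j = reverses c′ j k
      (trans (above j i≤j) (sym (above k (ℕP.≤-trans i≤j (ℕP.<⇒≤ j<k))))) j<k
    dec : ∀ j k → q j < q k → q (suc k) < q (suc j)
    dec j k j<k with ℕP.≤-<-connex (q k) (q i) | ℕP.≤-<-connex (q i) (q j)
    ... | inj₁ k≤i | _        = dec-below j k j<k k≤i
    ... | inj₂ i<k | inj₁ i≤j = dec-above j k j<k i≤j
    ... | inj₂ i<k | inj₂ j<i =
      ℕP.<-trans (dec-above i k i<k ℕP.≤-refl) (dec-below j i j<i ℕP.≤-refl)

  compatible-word-unique : ∀ {s s′} → 3 ≤ n → Compatible s q → Compatible s′ q → ∀ i → s i ≡ s′ i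
  compatible-word-unique {s} {s′} 3≤n c c′ i with FinP.<-cmp (s i) (s′ i)
  ... | tri≈ _ eq _ = eq
  ... | tri< lt _ _ = contradiction (∣⇒≤ (compatible-word-< c c′ i lt)) (ℕP.<⇒≱ 3≤n)
  ... | tri> _ _ gt = contradiction (∣⇒≤ (compatible-word-< c′ c i gt)) (ℕP.<⇒≱ 3≤n)

  module _ {s : ℕ → Fin 2} (c : Compatible s q) where

    -- A tie persists under shifting, so the letters agree at every step and `reverses` applies each
    -- time; two applications restore the direction.
    reverses² : ∀ i j → Tie s i j → q i < q j → ∀ h → q (h * 2 + i) < q (h * 2 + j)
    reverses² i j tie lt zero    = lt
    reverses² i j tie lt (suc h) =
      reverses c _ _ (sym (tie (suc (h * 2)))) (reverses c _ _ (tie (h * 2)) (reverses² i j tie lt h))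

    even-period⇒∣ : ∀ h → Period (h * 2) s → n ∣ h * 2
    even-period⇒∣ h per = monotone-shift⇒∣ (h * 2)
      (λ i lt → reverses² i (h * 2 + i) (tie i) lt h)
      (λ i lt → reverses² (h * 2 + i) i (λ d → sym (tie i d)) lt h)
      where
      tie : ∀ i → Tie s i (h * 2 + i)
      tie i d = sym (trans (cong s (trans (sym (ℕP.+-assoc d (h * 2) i)) (trans (cong (_+ i) (ℕP.+-comm d (h * 2))) (ℕP.+-assoc (h * 2) d i)))) (per (d + i)))

    period⇒∣double : ∀ p → Period p s → n ∣ p * 2
    period⇒∣double p perp = even-period⇒∣ p (subst (λ t → Period t s) (ℕP.*-comm 2 p) (period-* 2 perp))

    -- A period `p` satisfies `n ∣ p * 2`, and oddness of `n` removes the factor 2: in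
    -- `p * n ≡ p * 2 * h + p` both `p * n` and `p * 2 * h` are multiples of `n`.
    odd⇒primitive : ∀ h → n ≡ 1 + h * 2 → Period n s → Prim n s
    odd⇒primitive h eq per = per , λ p perp →
      ∣m+n∣m⇒∣n
        (subst (n ∣_) (identity p) (n∣m*n p))
        (∣m⇒∣m*n h (period⇒∣double p perp))
      where
      open ≡-Reasoning
      identity : ∀ p → p * n ≡ p * 2 * h + p
      identity p = begin
        p * n              ≡⟨ cong (p *_) eq ⟩
        p * (1 + h * 2)    ≡⟨ ℕP.*-distribˡ-+ p 1 (h * 2) ⟩
        p * 1 + p * (h * 2) ≡⟨ cong₂ _+_ (ℕP.*-identityʳ p) (cong (p *_) (ℕP.*-comm h 2)) ⟩
        p + p * (2 * h)    ≡⟨ ℕP.+-comm p _ ⟩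
        p * (2 * h) + p    ≡⟨ cong (_+ p) (sym (ℕP.*-assoc p 2 h)) ⟩
        p * 2 * h + p      ∎

    -- Every period is a multiple of `m`, because `m * 2` divides its double. An odd multiple would,
    -- after cancelling multiples of `n`, make `m` itself a period; so either `m` is a period or all
    -- periods are even multiples of `m`, that is, multiples of `n`.
    even⇒primitive-or-square : ∀ m → n ≡ m * 2 → Period n s → Prim n s ⊎ Prim m s
    even⇒primitive-or-square m refl per with period? per m
    ... | yes perm = inj₂ (perm , λ p perp → *-cancelʳ-∣ 2 (period⇒∣double p perp))
    ... | no ¬perm = inj₁ (per , n∣)
      where
      n∣ : ∀ p → Period p s → m * 2 ∣ p
      n∣ p perp with *-cancelʳ-∣ {m} {p} 2 (period⇒∣double p perp)
      ... | divides c refl with even-or-odd c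
      ... | inj₁ (h , refl) = divides h (trans (ℕP.*-assoc h 2 m) (cong (h *_) (ℕP.*-comm 2 m)))
      ... | inj₂ (h , refl) = contradiction
        (period-cancelˡ (h * (m * 2))
          (subst (λ t → Period t s)
            (trans (ℕP.+-comm m _) (cong (_+ m) (trans (ℕP.*-assoc h 2 m) (cong (h *_) (ℕP.*-comm 2 m))))) perp)
          (period-* h per))
        ¬perm

-- FirstDiff s d i j: the i-th and j-th shifts of s first differ at index d, and the
-- i-th one is the smaller in the alternating order.
FirstDiff : (ℕ → Fin 2) → ℕ → ℕ → ℕ → Set
FirstDiff s zero    i j = s i Fin.< s j
FirstDiff s (suc d) i j = s i ≡ s j × FirstDiff s d (suc j) (suc i)

data Comparison (s : ℕ → Fin 2) (n i j : ℕ) : Set where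
  before : ∀ d → d < n → FirstDiff s d i j → Comparison s n i j
  after  : ∀ d → d < n → FirstDiff s d j i → Comparison s n i j
  tied   : Tie s i j → Comparison s n i j

compare : ∀ {n} .{{_ : NonZero n}} {s} → Period n s → ∀ i j → Comparison s n i j
compare {n} {s} per i j = conclude (search n i j)
  where
  search : ∀ N i j → (∃ λ d → d < N × FirstDiff s d i j) ⊎ (∃ λ d → d < N × FirstDiff s d j i)
                   ⊎ (∀ d → d < N → s (d + i) ≡ s (d + j))
  search zero    i j = inj₂ (inj₂ λ d ())
  search (suc N) i j with FinP.<-cmp (s i) (s j)
  ... | tri< lt _ _ = inj₁ (0 , s≤s z≤n , lt)
  ... | tri> _ _ gt = inj₂ (inj₁ (0 , s≤s z≤n , gt))
  -- After an equal letter the roles of the two tails are exchanged, as the order alternates.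
  ... | tri≈ _ eq _ with search N (suc j) (suc i)
  ... | inj₁ (d , d<N , fd)        = inj₁ (suc d , s≤s d<N , eq , fd)
  ... | inj₂ (inj₁ (d , d<N , fd)) = inj₂ (inj₁ (suc d , s≤s d<N , sym eq , fd))
  ... | inj₂ (inj₂ agree)          = inj₂ (inj₂ λ
    { zero    _         → eq
    ; (suc d) (s≤s d<N) → subst₂ (λ x y → s x ≡ s y) (ℕP.+-suc d i) (ℕP.+-suc d j) (sym (agree d d<N)) })
  conclude : _ → Comparison s n i j
  conclude (inj₁ (d , d<n , fd))        = before d d<n fd
  conclude (inj₂ (inj₁ (d , d<n , fd))) = after d d<n fd
  -- Agreement on one full period is agreement everywhere, so `n` letters suffice to detect a
  -- difference.
  conclude (inj₂ (inj₂ agree))          =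
    tied (periodic-ext (period-shift i per) (period-shift j per) agree)

module _ {n : ℕ} .{{_ : NonZero n}} {s : ℕ → Fin 2} where

  -- `reverses` only carries order from `i`, `j` to their successors. It is pulled back by
  -- trichotomy: equality or the opposite order at `i`, `j` would be carried forward and contradict
  -- the induction hypothesis.
  firstDiff⇒< : ∀ {q} → Cyclic n q → Compatible s q → ∀ d i j → FirstDiff s d i j → q i < q j
  firstDiff⇒< C c zero i j lt = letters c i j lt
  firstDiff⇒< {q} C c (suc d) i j (eq , fd) with ℕP.<-cmp (q i) (q j)
  ... | tri< lt _ _ = lt
  ... | tri≈ _ q≡ _ = contradiction (firstDiff⇒< C c d (suc j) (suc i) fd) (ℕP.<-irrefl (sym (cyclic-suc-cong C i j q≡)))
  ... | tri> _ _ gt = contradiction (firstDiff⇒< C c d (suc j) (suc i) fd) (ℕP.<⇒≯ (reverses c j i (sym eq) gt))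

  -- Compatibility fixes the order of any two different shifts, so two compatible orderings can
  -- disagree only on ties.
  order-determined : ∀ {q q′} → Period n s → Cyclic n q → Compatible s q → Cyclic n q′ → Compatible s q′ →
    (∀ i j → Tie s i j → q i < q j → q′ i < q′ j) → ∀ i j → q i < q j → q′ i < q′ j
  order-determined per C c C′ c′ ties i j lt with compare per i j
  ... | before d _ fd = firstDiff⇒< C′ c′ d i j fd
  ... | after  d _ fd = contradiction (firstDiff⇒< C c d j i fd) (ℕP.<⇒≯ lt)
  ... | tied tie      = ties i j tie lt

-- The shifts of s are ordered by the numbers with digits s i, s (i + 1), … in base −2,
-- truncated after N digits; the rank f, in {0, 1}, breaks ties.
key : (ℕ → Fin 2) → (ℕ → ℕ) → ℕ → ℕ → ℕ
key s f zero    i = f i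
key s f (suc N) i = suc (toℕ (s i)) * 2 ^ suc N ∸ suc (key s f N (suc i))

-- `f` stands for one last digit behind the truncation, hence the bound 2. The conditions
-- `alternates` and `separates` are asked on ties only, since elsewhere the digits of the word
-- decide.
record Tiebreak (n : ℕ) .{{_ : NonZero n}} (s : ℕ → Fin 2) (f : ℕ → ℕ) : Set where
  field
    bounded    : ∀ i → f i < 2
    f-period   : Period n f
    alternates : ∀ i j → Tie s i j → f i < f j → f (suc j) < f (suc i)
    separates  : ∀ i j → Tie s i j → f i ≡ f j → i % n ≡ j % n

module Key {n : ℕ} .{{_ : NonZero n}} {s : ℕ → Fin 2} {f : ℕ → ℕ} (per : Period n s) (t : Tiebreak n s f) where
  open Tiebreak t

  private
    k : ℕ → ℕ → ℕ
    k = key s f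

  -- The bound keeps the subtraction in `key` from truncating: with `suc N` digits the key lies in
  -- the block of width `2 ^ suc N` chosen by the letter, and the key of the tail is reflected
  -- inside this block. Different letters give disjoint blocks; equal letters give a reversal.
  key-bound : ∀ N i → k N i < 2 ^ suc N
  key-bound zero    i = bounded i
  key-bound (suc N) i = ℕP.<-≤-trans
    (ℕP.∸-monoʳ-< {o = 0} (s≤s z≤n) (ℕP.≤-trans (key-bound N (suc i)) (ℕP.m≤m+n (2 ^ suc N) _)))
    (ℕP.*-monoˡ-≤ (2 ^ suc N) (FinP.toℕ<n (s i)))

  key-letter : ∀ N i j → s i Fin.< s j → k (suc N) i < k (suc N) j
  key-letter N i j lt with s i | s j | Fin2-<-bounds lt
  ... | _ | _ | refl , refl = ℕP.<-≤-trans
    (ℕP.<-≤-trans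
      (ℕP.∸-monoʳ-< {o = 0} (s≤s z≤n) (ℕP.≤-trans (key-bound N (suc i)) (ℕP.m≤m+n (2 ^ suc N) _)))
      (ℕP.≤-reflexive (ℕP.+-identityʳ (2 ^ suc N))))
    (ℕP.m+n≤o⇒m≤o∸n (2 ^ suc N) (ℕP.+-monoʳ-≤ (2 ^ suc N) (ℕP.≤-trans (key-bound N (suc j)) (ℕP.m≤m+n (2 ^ suc N) _))))

  key-reverse : ∀ N i j → s i ≡ s j → k N (suc j) < k N (suc i) → k (suc N) i < k (suc N) j
  key-reverse N i j eq lt rewrite eq =
    ℕP.∸-monoʳ-< (s≤s lt) (ℕP.≤-trans (key-bound N (suc i)) (ℕP.m≤m+n (2 ^ suc N) _))

  firstDiff⇒key< : ∀ N d i j → d < N → FirstDiff s d i j → k N i < k N j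
  firstDiff⇒key< (suc N) zero    i j _         lt        = key-letter N i j lt
  firstDiff⇒key< (suc N) (suc d) i j (s≤s d<N) (eq , fd) =
    key-reverse N i j eq (firstDiff⇒key< N d (suc j) (suc i) d<N fd)

  tie-suc : ∀ i j → Tie s i j → Tie s (suc j) (suc i)
  tie-suc i j tie d = subst₂ (λ x y → s x ≡ s y) (sym (ℕP.+-suc d j)) (sym (ℕP.+-suc d i)) (sym (tie (suc d)))

  tie-pred : ∀ i j → s i ≡ s j → Tie s (suc i) (suc j) → Tie s i j
  tie-pred i j eq tie zero    = eq
  tie-pred i j eq tie (suc d) = subst₂ (λ x y → s x ≡ s y) (ℕP.+-suc d i) (ℕP.+-suc d j) (tie d)

  tie⇒key< : ∀ N i j → Tie s i j → f i < f j → k N i < k N j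
  tie⇒key< zero    i j tie lt = lt
  tie⇒key< (suc N) i j tie lt =
    key-reverse N i j (tie 0) (tie⇒key< N (suc j) (suc i) (tie-suc i j tie) (alternates i j tie lt))

  key-period : ∀ N → Period n (k N)
  key-period zero    = f-period
  key-period (suc N) i = cong₂ (λ a b → suc (toℕ a) * 2 ^ suc N ∸ suc b) (per i)
    (trans (cong (k N) (sym (ℕP.+-suc n i))) (key-period N (suc i)))

  -- One digit more than the period: different shifts differ at an index below `n`, and for
  -- `reverses` this index is preceded by one further, equal letter.
  K : ℕ → ℕ
  K = k (suc n)

  key-cyclic : Cyclic n K
  key-cyclic .period = key-period (suc n)
  key-cyclic .injective i j eq with compare per i j
  ... | before d d<n fd = contradiction (firstDiff⇒key< (suc n) d i j (ℕP.m<n⇒m<1+n d<n) fd) (ℕP.<-irrefl eq)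
  ... | after  d d<n fd = contradiction (firstDiff⇒key< (suc n) d j i (ℕP.m<n⇒m<1+n d<n) fd) (ℕP.<-irrefl (sym eq))
  ... | tied tie with ℕP.<-cmp (f i) (f j)
  ... | tri< lt _ _ = contradiction (tie⇒key< (suc n) i j tie lt) (ℕP.<-irrefl eq)
  ... | tri≈ _ f≡ _ = separates i j tie f≡
  ... | tri> _ _ gt = contradiction (tie⇒key< (suc n) j i (λ d → sym (tie d)) gt) (ℕP.<-irrefl (sym eq))

  -- The recursion of `key` relates different numbers of digits, whereas compatibility compares keys
  -- with the same number. The order of the tails is therefore read off from their first difference
  -- or, on a tie, from `f`.
  key-compatible : Compatible s K
  key-compatible .letters i j = key-letter n i j
  key-compatible .reverses i j eq lt with compare per (suc i) (suc j)
  ... | after  d d<n fd = firstDiff⇒key< (suc n) d (suc j) (suc i) (ℕP.m<n⇒m<1+n d<n) fd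
  ... | before d d<n fd = contradiction (firstDiff⇒key< (suc n) (suc d) j i (s≤s d<n) (sym eq , fd)) (ℕP.<⇒≯ lt)
  ... | tied tie⁺ with ℕP.<-cmp (f i) (f j)
  ... | tri< f< _ _ = tie⇒key< (suc n) (suc j) (suc i) (λ d → sym (tie⁺ d)) (alternates i j (tie-pred i j eq tie⁺) f<)
  ... | tri≈ _ f≡ _ = contradiction lt (ℕP.<-irrefl (period-cong (key-period (suc n)) (separates i j (tie-pred i j eq tie⁺) f≡)))
  ... | tri> _ _ f> = contradiction (tie⇒key< (suc n) j i (λ d → sym (tie-pred i j eq tie⁺ d)) f>) (ℕP.<⇒≯ lt)

-- Permutations and ranks

pos : ∀ {n} .{{_ : NonZero n}} → Vec (Fin n) n → ℕ → ℕ
pos π i = toℕ (cyc π i)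

module _ {A : Set} {P Q : A → Set} (P? : ∀ x → Dec (P x)) (Q? : ∀ x → Dec (Q x)) (P⊆Q : ∀ x → P x → Q x) where

  length-filter-mono : ∀ xs → length (filter P? xs) ≤ length (filter Q? xs)
  length-filter-mono [] = z≤n
  length-filter-mono (x ∷ xs) with P? x | Q? x
  ... | yes p | yes _ = s≤s (length-filter-mono xs)
  ... | yes p | no ¬q = contradiction (P⊆Q x p) ¬q
  ... | no _  | yes _ = ℕP.m≤n⇒m≤1+n (length-filter-mono xs)
  ... | no _  | no _  = length-filter-mono xs

  length-filter-mono-< : ∀ xs {x} → x ∈ xs → ¬ P x → Q x → length (filter P? xs) < length (filter Q? xs)
  length-filter-mono-< (x ∷ xs) (here refl) ¬p q with P? x | Q? x
  ... | yes p | _     = contradiction p ¬p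
  ... | no _  | yes _ = s≤s (length-filter-mono xs)
  ... | no _  | no ¬q = contradiction q ¬q
  length-filter-mono-< (x ∷ xs) (there x∈) ¬p q with P? x | Q? x
  ... | yes p | yes _ = s≤s (length-filter-mono-< xs x∈ ¬p q)
  ... | yes p | no ¬q = contradiction (P⊆Q x p) ¬q
  ... | no _  | yes _ = ℕP.m≤n⇒m≤1+n (length-filter-mono-< xs x∈ ¬p q)
  ... | no _  | no _  = length-filter-mono-< xs x∈ ¬p q

-- Pigeonhole: a missed value could be punched out of the codomain, leaving an injection into a
-- smaller set.
injective⇒surjective : ∀ {n} (f : Fin n → Fin n) → (∀ i j → f i ≡ f j → i ≡ j) → ∀ y → ∃ λ x → f x ≡ y
injective⇒surjective {suc n} f inj y with FinP.any? (λ x → f x FinP.≟ y)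
... | yes found = found
... | no ¬found = contradiction (FinP.injective⇒≤ {f = g} g-injective) ℕP.1+n≰n
  where
  y≢ : ∀ x → y ≢ f x
  y≢ x eq = ¬found (x , sym eq)
  g : Fin (suc n) → Fin n
  g x = Fin.punchOut (y≢ x)
  g-injective : ∀ {i j} → g i ≡ g j → i ≡ j
  g-injective {i} {j} eq = inj i j (FinP.punchOut-injective (y≢ i) (y≢ j) eq)

module _ {n : ℕ} .{{_ : NonZero n}} where

  pos-cyclic : (π : Vec (Fin n) n) → IsPerm π → Cyclic n (pos π)
  pos-cyclic π perm .period i = cong toℕ (cyc-period π i)
  pos-cyclic π perm .injective i j eq = begin
    i % n            ≡⟨ sym (toℕ-mod i) ⟩
    toℕ (i mod n)    ≡⟨ cong toℕ (perm (i mod n) (j mod n) (FinP.toℕ-injective eq)) ⟩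
    toℕ (j mod n)    ≡⟨ toℕ-mod j ⟩
    j % n            ∎
    where open ≡-Reasoning

  order-reflecting : ∀ {q q′} → Cyclic n q → Cyclic n q′ →
    (∀ i j → q i < q j → q′ i < q′ j) → ∀ i j → q′ i < q′ j → q i < q j
  order-reflecting {q} {q′} C C′ mono i j lt with ℕP.<-cmp (q i) (q j)
  ... | tri< l _ _ = l
  ... | tri≈ _ e _ = contradiction lt (ℕP.<-irrefl (period-cong (period C′) (injective C i j e)))
  ... | tri> _ _ g = contradiction (mono j i g) (ℕP.<⇒≯ lt)

  -- Induction on the value `c`: the position where `π` takes the preceding value has a `π′`-value
  -- at least that large, and monotonicity raises it strictly.
  order-isomorphic-≤ : (π π′ : Vec (Fin n) n) → IsPerm π →
    (∀ i j → pos π i < pos π j → pos π′ i < pos π′ j) → ∀ i → pos π i ≤ pos π′ i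
  order-isomorphic-≤ π π′ perm mono i = go (pos π i) i refl
    where
    go : ∀ c i → pos π i ≡ c → c ≤ pos π′ i
    go zero    i eq = z≤n
    go (suc c) i eq with injective⇒surjective (lookup π) perm (fromℕ< (ℕP.<-trans (ℕP.n<1+n c) (subst (_< n) eq (FinP.toℕ<n (cyc π i)))))
    ... | x , πx = ℕP.≤-<-trans (go c (toℕ x) posx) (mono (toℕ x) i (subst₂ _<_ (sym posx) (sym eq) (ℕP.n<1+n c)))
      where
      posx : pos π (toℕ x) ≡ c
      posx = trans (cong toℕ (trans (cyc-toℕ π x) πx)) (FinP.toℕ-fromℕ< _)

  order-isomorphic⇒≡ : (π π′ : Vec (Fin n) n) → IsPerm π → IsPerm π′ →
    (∀ i j → pos π i < pos π j → pos π′ i < pos π′ j) → π ≡ π′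
  order-isomorphic⇒≡ π π′ perm perm′ mono = cyc-injective π π′ λ i → FinP.toℕ-injective
    (ℕP.≤-antisym (order-isomorphic-≤ π π′ perm mono i)
      (order-isomorphic-≤ π′ π perm′ (order-reflecting (pos-cyclic π perm) (pos-cyclic π′ perm′) mono) i))

  rank : (ℕ → ℕ) → ℕ → ℕ
  rank K i = length (filter (λ j → K j ℕP.<? K i) (upTo n))

  rank-< : ∀ K i → i < n → rank K i < n
  rank-< K i i<n = subst (rank K i <_) (ListP.length-upTo n)
    (ListP.filter-notAll (λ j → K j ℕP.<? K i) (upTo n) (Any.map (λ { refl → ℕP.<-irrefl refl }) (∈-upTo⁺ i<n)))

  rankVec : (ℕ → ℕ) → Vec (Fin n) n
  rankVec K = Vec.tabulate (λ i → fromℕ< (rank-< K (toℕ i) (FinP.toℕ<n i)))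

  module _ {K : ℕ → ℕ} (C : Cyclic n K) where

    pos-rankVec : ∀ i → pos (rankVec K) i ≡ rank K i
    pos-rankVec i = begin
      toℕ (lookup (rankVec K) (i mod n))   ≡⟨ cong toℕ (VecP.lookup∘tabulate _ (i mod n)) ⟩
      toℕ (fromℕ< (rank-< K (toℕ (i mod n)) (FinP.toℕ<n (i mod n))))   ≡⟨ FinP.toℕ-fromℕ< _ ⟩
      rank K (toℕ (i mod n))               ≡⟨ cong (rank K) (toℕ-mod i) ⟩
      rank K (i % n)                       ≡⟨ sym (cong (λ a → length (filter (λ j → K j ℕP.<? a) (upTo n))) (period-% (period C) i)) ⟩
      rank K i                             ∎
      where open ≡-Reasoning

    -- Strictness comes from the representative `i % n`, which is counted for `j` but not for `i`.
    rankVec-mono : ∀ i j → K i < K j → pos (rankVec K) i < pos (rankVec K) j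
    rankVec-mono i j lt = subst₂ _<_ (sym (pos-rankVec i)) (sym (pos-rankVec j))
      (length-filter-mono-< _ _ (λ x x<i → ℕP.<-trans x<i lt) (upTo n) (∈-upTo⁺ (m%n<n i n))
        (λ l → ℕP.<-irrefl (sym (period-% (period C) i)) l)
        (subst (_< K j) (period-% (period C) i) lt))

    rankVec-perm : IsPerm (rankVec K)
    rankVec-perm i j eq with ℕP.<-cmp (K (toℕ i)) (K (toℕ j))
    ... | tri≈ _ e _ = FinP.toℕ-injective (begin
      toℕ i        ≡⟨ sym (m<n⇒m%n≡m (FinP.toℕ<n i)) ⟩
      toℕ i % n    ≡⟨ injective C (toℕ i) (toℕ j) e ⟩
      toℕ j % n    ≡⟨ m<n⇒m%n≡m (FinP.toℕ<n j) ⟩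
      toℕ j        ∎)
      where open ≡-Reasoning
    ... | tri< l _ _ = contradiction (rankVec-mono _ _ l) (ℕP.<-irrefl (cong toℕ (trans (cyc-toℕ (rankVec K) i) (trans eq (sym (cyc-toℕ (rankVec K) j))))))
    ... | tri> _ _ g = contradiction (rankVec-mono _ _ g) (ℕP.<-irrefl (cong toℕ (trans (cyc-toℕ (rankVec K) j) (trans (sym eq) (sym (cyc-toℕ (rankVec K) i))))))

    rankVec-cyclic : Cyclic n (pos (rankVec K))
    rankVec-cyclic = pos-cyclic (rankVec K) rankVec-perm

    rankVec-compatible : ∀ {s} → Compatible s K → Compatible s (pos (rankVec K))
    rankVec-compatible c .letters i j lt = rankVec-mono i j (letters c i j lt)
    rankVec-compatible c .reverses i j eq lt = rankVec-mono (suc j) (suc i)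
      (reverses c i j eq (order-reflecting C rankVec-cyclic rankVec-mono i j lt))

compatible-cong : ∀ {s s′ q} → (∀ i → s i ≡ s′ i) → Compatible s q → Compatible s′ q
compatible-cong eq c .letters i j lt = letters c i j (subst₂ Fin._<_ (sym (eq i)) (sym (eq j)) lt)
compatible-cong eq c .reverses i j e = reverses c i j (trans (eq i) (trans e (sym (eq j))))

-- Breaking the ties of a square by parity

par : ℕ → ℕ
par zero    = 0
par (suc i) = 1 ∸ par i

par≤1 : ∀ i → par i ≤ 1
par≤1 zero    = z≤n
par≤1 (suc i) = ℕP.m∸n≤m 1 (par i)

par-even+ : ∀ h i → par (h * 2 + i) ≡ par i
par-even+ zero    i = refl
par-even+ (suc h) i = trans (ℕP.m∸[m∸n]≡n (par≤1 (h * 2 + i))) (par-even+ h i)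

par-alternates : ∀ i j → par i < par j → par (suc j) < par (suc i)
par-alternates i j lt = ℕP.∸-monoʳ-< lt (par≤1 j)

par-suc≢ : ∀ i → par (suc i) ≢ par i
par-suc≢ i eq with par i | par≤1 i
... | zero        | _ = contradiction eq λ ()
... | suc zero    | _ = contradiction eq λ ()
... | suc (suc _) | s≤s ()

module _ {n : ℕ} .{{_ : NonZero n}} {s : ℕ → Fin 2} where

  ordered-cases : (P : ℕ → ℕ → Set) → (∀ i j → P i j → P j i) → (∀ i p → P i (p + i)) → ∀ i j → P i j
  ordered-cases P P-sym P-+ i j with ℕP.≤-total i j
  ... | inj₁ i≤j = subst (P i) (ℕP.m∸n+n≡m i≤j) (P-+ i (j ∸ i))
  ... | inj₂ j≤i = P-sym j i (subst (P j) (ℕP.m∸n+n≡m j≤i) (P-+ j (i ∸ j)))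

  tie-primitive : Prim n s → ∀ i j → Tie s i j → i % n ≡ j % n
  tie-primitive (per , prim) = ordered-cases (λ i j → Tie s i j → i % n ≡ j % n)
    (λ i j h tie → sym (h (λ d → sym (tie d))))
    (λ i p tie → sym (%-remove-+ˡ i (prim p (tie⇒period per i p tie))))

  -- A constant works here because ties occur only between positions that are equal modulo `n`;
  -- `alternates` is then vacuous.
  primitive-tiebreak : Prim n s → Tiebreak n s (λ _ → 0)
  primitive-tiebreak prim = record
    { bounded    = λ _ → s≤s z≤n
    ; f-period   = λ _ → refl
    ; alternates = λ _ _ _ ()
    ; separates  = λ i j tie _ → tie-primitive prim i j tie
    }

module Square {n m h : ℕ} .{{_ : NonZero n}} .{{_ : NonZero m}} (n≡ : n ≡ m * 2) (m≡ : m ≡ 1 + h * 2)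
  {s : ℕ → Fin 2} (prim : Prim m s) where

  2m+ : ∀ i → (m + (m + i)) % n ≡ i % n
  2m+ i = trans (cong (_% n) (sym (ℕP.+-assoc m m i)))
    (%-remove-+ˡ i (∣-reflexive (trans n≡ (trans (ℕP.*-comm m 2) (cong (λ t → m + t) (ℕP.+-identityʳ m))))))

  square-period : Period n s
  square-period = subst (λ t → Period t s) (trans (ℕP.*-comm 2 m) (sym n≡)) (period-* 2 (proj₁ prim))

  -- The distance of two tied positions is a multiple of `m`: an even multiple vanishes modulo `n`,
  -- an odd one leaves `m`.
  tie-square : ∀ i j → Tie s i j → i % n ≡ j % n ⊎ j % n ≡ (m + i) % n
  tie-square = ordered-cases {n} {s} (λ i j → Tie s i j → i % n ≡ j % n ⊎ j % n ≡ (m + i) % n) flip split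
    where
    flip : ∀ i j → (Tie s i j → i % n ≡ j % n ⊎ j % n ≡ (m + i) % n) → Tie s j i → j % n ≡ i % n ⊎ i % n ≡ (m + j) % n
    flip i j hyp tie with hyp (λ d → sym (tie d))
    ... | inj₁ eq = inj₁ (sym eq)
    ... | inj₂ eq = inj₂ (begin
      i % n                        ≡⟨ sym (2m+ i) ⟩
      (m + (m + i)) % n            ≡⟨ %-distribˡ-+ m (m + i) n ⟩
      (m % n + (m + i) % n) % n    ≡⟨ cong (λ t → (m % n + t) % n) (sym eq) ⟩
      (m % n + j % n) % n          ≡⟨ sym (%-distribˡ-+ m j n) ⟩
      (m + j) % n                  ∎)
      where open ≡-Reasoning
    n∣2m : ∀ g → n ∣ g * 2 * m
    n∣2m g = divides g (trans (ℕP.*-assoc g 2 m) (cong (g *_) (trans (ℕP.*-comm 2 m) (sym n≡))))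
    split : ∀ i p → Tie s i (p + i) → i % n ≡ (p + i) % n ⊎ (p + i) % n ≡ (m + i) % n
    split i p tie with proj₂ prim p (tie⇒period square-period i p tie)
    ... | divides c refl with even-or-odd c
    ... | inj₁ (g , refl) = inj₁ (sym (%-remove-+ˡ i (n∣2m g)))
    ... | inj₂ (g , refl) = inj₂ (trans
      (cong (_% n) (trans (cong (_+ i) (ℕP.+-comm m (g * 2 * m))) (ℕP.+-assoc (g * 2 * m) m i)))
      (%-remove-+ˡ (m + i) (n∣2m g)))

  -- The point where oddness of `m` enters: half a turn flips the parity and so separates the two
  -- tied positions, while a full turn `n` preserves it.
  par-m+ : ∀ i → par (m + i) ≡ par (suc i)
  par-m+ i = trans (cong (λ t → par (t + i)) m≡) (cong (1 ∸_) (par-even+ h i))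

  par-period : ∀ b → Period n (λ i → par (i + b))
  par-period b i = trans (cong (λ t → par (t + i + b)) n≡)
    (trans (cong par (ℕP.+-assoc (m * 2) i b)) (par-even+ m (i + b)))

  -- The parity of the offset `b` selects one of two opposite ways to break the ties.
  parity-tiebreak : ∀ b → Tiebreak n s (λ i → par (i + b))
  parity-tiebreak b = record
    { bounded    = λ i → s≤s (par≤1 (i + b))
    ; f-period   = par-period b
    ; alternates = λ i j _ → par-alternates (i + b) (j + b)
    ; separates  = sep
    }
    where
    sep : ∀ i j → Tie s i j → par (i + b) ≡ par (j + b) → i % n ≡ j % n
    sep i j tie eq with tie-square i j tie
    ... | inj₁ i≡j = i≡j
    ... | inj₂ j≡m+i = contradiction
      (begin
        par (suc (i + b))      ≡⟨ sym (par-m+ (i + b)) ⟩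
        par (m + (i + b))      ≡⟨ cong par (sym (ℕP.+-assoc m i b)) ⟩
        par (m + i + b)        ≡⟨ sym (period-cong (par-period b) j≡m+i) ⟩
        par (j + b)            ≡⟨ sym eq ⟩
        par (i + b)            ∎)
      (par-suc≢ (i + b))
      where open ≡-Reasoning

  -- All ties are resolved as the one between the shifts 0 and m is.
  ties-determined : ∀ {q q′} → Cyclic n q → Compatible s q → Cyclic n q′ → Compatible s q′ →
    (q 0 < q m → q′ 0 < q′ m) → (q m < q 0 → q′ m < q′ 0) →
    ∀ i j → Tie s i j → q i < q j → q′ i < q′ j
  ties-determined {q} {q′} C c C′ c′ up down i j tie lt with tie-square i j tie
  ... | inj₁ eq = contradiction lt (ℕP.<-irrefl (period-cong (Cyclic.period C) eq))
  ... | inj₂ eq = subst (q′ i <_) (sym (period-cong (Cyclic.period C′) eq))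
    (proj₁ (go i) (subst (q i <_) (period-cong (Cyclic.period C) eq) lt))
    where
    open Compatible
    back : ∀ {q} → Cyclic n q → Compatible s q → ∀ i j → s i ≡ s j → q (suc i) < q (suc j) → q j < q i
    back {q} C c i j eq lt with ℕP.<-cmp (q i) (q j)
    ... | tri< l _ _ = contradiction (reverses c i j eq l) (ℕP.<⇒≯ lt)
    ... | tri≈ _ e _ = contradiction lt (ℕP.<-irrefl (cyclic-suc-cong C i j e))
    ... | tri> _ _ g = g
    -- Both directions are carried along together, since each shift by one turns either into the
    -- other.
    go : ∀ i → (q i < q (m + i) → q′ i < q′ (m + i)) × (q (m + i) < q i → q′ (m + i) < q′ i)
    go zero    = subst (λ t → (q 0 < q t → q′ 0 < q′ t) × (q t < q 0 → q′ t < q′ 0)) (sym (ℕP.+-identityʳ m)) (up , down)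
    go (suc i) rewrite ℕP.+-suc m i =
      (λ l → reverses c′ (m + i) i (proj₁ prim i) (proj₂ (go i) (back C c i (m + i) (sym (proj₁ prim i)) l))) ,
      (λ l → reverses c′ i (m + i) (sym (proj₁ prim i)) (proj₁ (go i) (back C c (m + i) i (proj₁ prim i) l)))

-- Counting compatible orderings

Ordering : (n : ℕ) .{{_ : NonZero n}} → Vec (Fin n) n → Set
Ordering n π = IsPerm π × Σ (ℕ → Fin 2) λ s → Period n s × Compatible s (pos π)

-- A period can be reduced modulo `n`, so finitely many candidates decide primitivity.
prim-below : ∀ {n} .{{_ : NonZero n}} {s : ℕ → Fin 2} → Period n s →
  (∀ p → p < n → Period p s → n ∣ p) → Prim n s
prim-below {n} {s} per below = per , λ p perp → ∣n∣m%n⇒∣m ∣-refl (below (p % n) (m%n<n p n)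
  (period-cancelˡ (p / n * n)
    (subst (λ t → Period t s) (trans (m≡m%n+[m/n]*n p n) (ℕP.+-comm (p % n) _)) perp)
    (period-* (p / n) per)))

prim? : ∀ {n} .{{_ : NonZero n}} {s : ℕ → Fin 2} → Period n s → Dec (Prim n s)
prim? {n} per = map′ (λ h → prim-below per (λ p → h {p})) (λ prim {p} _ → proj₂ prim p)
  (ℕP.allUpTo? (λ p → period? per p →-dec (n ∣? p)) n)

IsPrim : (n : ℕ) .{{_ : NonZero n}} → Vec (Fin 2) n → Set
IsPrim n w = Prim n (cyc w)

primCount : (n : ℕ) .{{_ : NonZero n}} → ℕ
primCount n = length (filter (λ w → prim? (cyc-period w)) (allVecs 2 n))

card-primitive : (n : ℕ) .{{_ : NonZero n}} → Card (IsPrim n) (primCount n)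
card-primitive n = card-filter (λ w → prim? (cyc-period w)) (allVecs-enumerates 2 n)

prim-cong : ∀ {n} {s s′ : ℕ → Fin 2} → (∀ i → s i ≡ s′ i) → Prim n s → Prim n s′
prim-cong {n} eq (per , prim) =
  (λ i → trans (sym (eq (n + i))) (trans (per i) (eq i))) ,
  λ p per′ → prim p (λ i → trans (eq (p + i)) (trans (per′ i) (sym (eq i))))

pattern-of : (n : ℕ) .{{_ : NonZero n}} → (ℕ → Fin 2) → (ℕ → ℕ) → Vec (Fin n) n
pattern-of n s f = rankVec (key s f (suc n))

module _ {n : ℕ} .{{_ : NonZero n}} where

  module Pattern {s : ℕ → Fin 2} {f : ℕ → ℕ} (per : Period n s) (t : Tiebreak n s f) where
    open Key per t

    perm : IsPerm (pattern-of n s f)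
    perm = rankVec-perm key-cyclic

    cyclic : Cyclic n (pos (pattern-of n s f))
    cyclic = rankVec-cyclic key-cyclic

    compatible : Compatible s (pos (pattern-of n s f))
    compatible = rankVec-compatible key-cyclic key-compatible

    ordering : Ordering n (pattern-of n s f)
    ordering = perm , s , per , compatible

    tied-< : ∀ i j → Tie s i j → f i < f j → pos (pattern-of n s f) i < pos (pattern-of n s f) j
    tied-< i j tie lt = rankVec-mono key-cyclic i j (tie⇒key< (suc n) i j tie lt)

  pattern-word-unique : 3 ≤ n → ∀ {s s′ f f′} → Period n s → Period n s′ → Tiebreak n s f → Tiebreak n s′ f′ →
    pattern-of n s f ≡ pattern-of n s′ f′ → ∀ i → s i ≡ s′ i
  pattern-word-unique 3≤n {s} {s′} per per′ t t′ eq =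
    compatible-word-unique (Pattern.cyclic per t) 3≤n (Pattern.compatible per t)
      (subst (λ π → Compatible s′ (pos π)) (sym eq) (Pattern.compatible per′ t′))

  primitive-ordering-unique : ∀ {s} (π π′ : Vec (Fin n) n) → Prim n s → IsPerm π → IsPerm π′ →
    Compatible s (pos π) → Compatible s (pos π′) → π ≡ π′
  primitive-ordering-unique {s} π π′ prim p p′ c c′ = order-isomorphic⇒≡ π π′ p p′
    (order-determined (proj₁ prim) (pos-cyclic π p) c (pos-cyclic π′ p′) c′
      λ i j tie lt → contradiction lt (ℕP.<-irrefl (cong toℕ (cong (lookup π) (mod-cong {i = i} {j} (tie-primitive prim i j tie))))))

  word-vec : (s : ℕ → Fin 2) → Vec (Fin 2) n
  word-vec s = Vec.tabulate (s ∘ toℕ)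

  primPattern : Vec (Fin 2) n → Vec (Fin n) n
  primPattern w = pattern-of n (cyc w) (λ _ → 0)

  primPattern-injective : 3 ≤ n → ∀ v w → IsPrim n v → IsPrim n w → primPattern v ≡ primPattern w → v ≡ w
  primPattern-injective 3≤n v w pv pw eq = cyc-injective v w
    (pattern-word-unique 3≤n (cyc-period v) (cyc-period w) (primitive-tiebreak pv) (primitive-tiebreak pw) eq)

  primPattern-surjective : ∀ π {s} → IsPerm π → Compatible s (pos π) → Prim n s →
    ∃ λ w → IsPrim n w × primPattern w ≡ π
  primPattern-surjective π {s} p c prim =
    word-vec s , prim-w ,
    primitive-ordering-unique (primPattern (word-vec s)) π prim-w
      (Pattern.perm (cyc-period (word-vec s)) (primitive-tiebreak prim-w)) p
      (Pattern.compatible (cyc-period (word-vec s)) (primitive-tiebreak prim-w))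
      (compatible-cong s≡ c)
    where
    s≡ : ∀ i → s i ≡ cyc (word-vec s) i
    s≡ i = sym (cyc-tabulate s (proj₁ prim) i)
    prim-w : IsPrim n (word-vec s)
    prim-w = prim-cong s≡ prim

card-ordering-odd : ∀ n h .{{_ : NonZero n}} → 3 ≤ n → n ≡ 1 + h * 2 → Card (Ordering n) (primCount n)
card-ordering-odd n h 3≤n n≡ = card-bijection primPattern
  (λ w pw → Pattern.ordering (cyc-period w) (primitive-tiebreak pw))
  (primPattern-injective 3≤n)
  (λ { π (p , s , per , c) → primPattern-surjective π p c (odd⇒primitive (pos-cyclic π p) c h n≡ per) })
  (card-primitive n)

card-ordering-even : ∀ n m h .{{_ : NonZero n}} .{{_ : NonZero m}} → 3 ≤ n → n ≡ m * 2 → m ≡ 1 + h * 2 →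
  Card (Ordering n) (primCount n + primCount m * 2)
card-ordering-even n m h 3≤n n≡ m≡ = card-bijection Ψ Ψ-ordering Ψ-injective Ψ-surjective
  (card-⊎ (card-primitive n) (card-×Fin 2 (card-primitive m)))
  where
  Index : Set
  Index = Vec (Fin 2) n ⊎ (Vec (Fin 2) m × Fin 2)

  Valid : Index → Set
  Valid = Sum.[ IsPrim n , (λ y → IsPrim m (proj₁ y)) ]

  Ψ : Index → Vec (Fin n) n
  Ψ (inj₁ w)       = primPattern w
  -- The bit settles the tie between the shifts at 0 and `m`: zero puts the shift at 0 first, one
  -- puts the shift at `m` first.
  Ψ (inj₂ (w , b)) = pattern-of n (cyc w) (λ i → par (i + toℕ b))

  module S {s} (prim : Prim m s) = Square {n} {m} {h} n≡ m≡ prim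

  Ψ-ordering : ∀ x → Valid x → Ordering n (Ψ x)
  Ψ-ordering (inj₁ w)       p = Pattern.ordering (cyc-period w) (primitive-tiebreak p)
  Ψ-ordering (inj₂ (w , b)) p = Pattern.ordering (S.square-period p) (S.parity-tiebreak p (toℕ b))

  n∤m : ¬ (n ∣ m)
  n∤m n∣m = ℕP.<⇒≱ (subst (m <_) (sym n≡) (subst (m <_) (ℕP.*-comm 2 m) (ℕP.m<m+n m (ℕP.<-≤-trans (ℕ.>-nonZero⁻¹ m) (ℕP.m≤m+n m 0))))) (∣⇒≤ n∣m)

  tie-0-m : ∀ {s} → Prim m s → Tie s 0 m
  tie-0-m {s} prim d = trans (cong s (ℕP.+-identityʳ d)) (sym (trans (cong s (ℕP.+-comm d m)) (proj₁ prim d)))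

  order₀ : ∀ w (p : IsPrim m w) → pos (Ψ (inj₂ (w , Fin.zero))) 0 < pos (Ψ (inj₂ (w , Fin.zero))) m
  order₀ w p = Pattern.tied-< (S.square-period p) (S.parity-tiebreak p 0) 0 m (tie-0-m p)
    (subst (0 <_) (sym (S.par-m+ p 0)) (s≤s z≤n))

  order₁ : ∀ w (p : IsPrim m w) → pos (Ψ (inj₂ (w , Fin.suc Fin.zero))) m < pos (Ψ (inj₂ (w , Fin.suc Fin.zero))) 0
  order₁ w p = Pattern.tied-< (S.square-period p) (S.parity-tiebreak p 1) m 0 (λ d → sym (tie-0-m p d))
    (subst (_< 1) (sym (S.par-m+ p 1)) (s≤s z≤n))

  Ψ-injective : ∀ x y → Valid x → Valid y → Ψ x ≡ Ψ y → x ≡ y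
  Ψ-injective (inj₁ v) (inj₁ w) pv pw eq = cong inj₁ (primPattern-injective 3≤n v w pv pw eq)
  -- Both words unroll to the same sequence, so the primitive word `v` of length `n` would have the
  -- period `m`, although `n` does not divide `m`.
  Ψ-injective (inj₁ v) (inj₂ (w , b)) pv pw eq = contradiction
    (proj₂ pv m (λ i → trans (v≡w (m + i)) (trans (proj₁ pw i) (sym (v≡w i))))) n∤m
    where v≡w = pattern-word-unique 3≤n (cyc-period v) (S.square-period pw) (primitive-tiebreak pv) (S.parity-tiebreak pw (toℕ b)) eq
  Ψ-injective x@(inj₂ _) y@(inj₁ _) px py eq = sym (Ψ-injective y x py px (sym eq))
  Ψ-injective (inj₂ (v , b)) (inj₂ (w , c)) pv pw eq with
    cyc-injective v w (pattern-word-unique 3≤n (S.square-period pv) (S.square-period pw) (S.parity-tiebreak pv (toℕ b)) (S.parity-tiebreak pw (toℕ c)) eq)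
  ... | refl = cong (λ t → inj₂ (v , t)) (same b c eq)
    where
    same : ∀ b c → Ψ (inj₂ (v , b)) ≡ Ψ (inj₂ (v , c)) → b ≡ c
    same Fin.zero           Fin.zero           eq = refl
    same (Fin.suc Fin.zero) (Fin.suc Fin.zero) eq = refl
    same Fin.zero           (Fin.suc Fin.zero) eq =
      contradiction (order₀ v pv) (ℕP.<⇒≯ (subst (λ π → pos π m < pos π 0) (sym eq) (order₁ v pv)))
    same (Fin.suc Fin.zero) Fin.zero           eq =
      contradiction (order₀ v pv) (ℕP.<⇒≯ (subst (λ π → pos π m < pos π 0) eq (order₁ v pv)))

  Ψ-surjective : ∀ π → Ordering n π → ∃ λ x → Valid x × Ψ x ≡ π
  Ψ-surjective π (p , s , per , c) with even⇒primitive-or-square (pos-cyclic π p) c m n≡ per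
  ... | inj₁ prim with w , pw , eq ← primPattern-surjective π p c prim = inj₁ w , pw , eq
  ... | inj₂ prim = by-order (ℕP.<-cmp (pos π 0) (pos π m))
    where
    w : Vec (Fin 2) m
    w = word-vec s
    s≡ : ∀ i → s i ≡ cyc w i
    s≡ i = sym (cyc-tabulate s (proj₁ prim) i)
    pw : IsPrim m w
    pw = prim-cong s≡ prim
    conclude : ∀ b → let π′ = Ψ (inj₂ (w , b)) in
      (pos π 0 < pos π m → pos π′ 0 < pos π′ m) → (pos π m < pos π 0 → pos π′ m < pos π′ 0) → π′ ≡ π
    conclude b up down = sym (order-isomorphic⇒≡ π (Ψ (inj₂ (w , b))) p Pb.perm
      (order-determined (S.square-period pw) (pos-cyclic π p) (compatible-cong s≡ c) Pb.cyclic Pb.compatible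
        (S.ties-determined pw (pos-cyclic π p) (compatible-cong s≡ c) Pb.cyclic Pb.compatible up down)))
      where module Pb = Pattern (S.square-period pw) (S.parity-tiebreak pw (toℕ b))
    by-order : _ → ∃ λ x → Valid x × Ψ x ≡ π
    by-order (tri< lt _ _) = inj₂ (w , Fin.zero) , pw ,
      conclude Fin.zero (λ _ → order₀ w pw) (λ gt → contradiction gt (ℕP.<⇒≯ lt))
    by-order (tri> _ _ gt) = inj₂ (w , Fin.suc Fin.zero) , pw ,
      conclude (Fin.suc Fin.zero) (λ lt → contradiction lt (ℕP.<⇒≯ gt)) (λ _ → order₁ w pw)
    by-order (tri≈ _ eq _) = contradiction
      (m%n≡0⇒n∣m m n (trans (sym (Cyclic.injective (pos-cyclic π p) 0 m eq)) (m*n%n≡0 0 n))) n∤m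

-- Cyclic permutations with one ascent

-- The range of the entries is independent of the length, unlike in `ascents`, so that induction can
-- pass to the tail.
ascentsᵛ : ∀ {k n} → Vec (Fin k) n → ℕ
ascentsᵛ v = ascentsList (map toℕ (toList v))

-- A cut of the positions into two consecutive decreasing runs, either of which may be empty. Read
-- along a cycle, the colours become the letters of the word.
record Colouring {k n : ℕ} (v : Vec (Fin k) n) (c : Fin n → Fin 2) : Set where
  field
    monotone   : ∀ i j → i Fin.< j → c i Fin.≤ c j
    decreasing : ∀ i j → i Fin.< j → c i ≡ c j → lookup v j Fin.≤ lookup v i

open Colouring

ascents≡0⇒decreasing : ∀ {k n} (v : Vec (Fin k) n) → ascentsᵛ v ≡ 0 →
  ∀ i j → i Fin.< j → lookup v j Fin.≤ lookup v i
ascents≡0⇒decreasing (a Vec.∷ Vec.[]) _ Fin.zero (Fin.suc ())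
ascents≡0⇒decreasing (a Vec.∷ b Vec.∷ v) eq i j i<j with toℕ a <ᵇ toℕ b in a<b
ascents≡0⇒decreasing (a Vec.∷ b Vec.∷ v) () i j i<j | true
ascents≡0⇒decreasing (a Vec.∷ b Vec.∷ v) eq Fin.zero (Fin.suc Fin.zero) i<j | false =
  ℕP.≮⇒≥ (λ lt → subst T a<b (ℕP.<⇒<ᵇ lt))
ascents≡0⇒decreasing (a Vec.∷ b Vec.∷ v) eq Fin.zero (Fin.suc (Fin.suc j)) i<j | false =
  ℕP.≤-trans (ascents≡0⇒decreasing (b Vec.∷ v) eq Fin.zero (Fin.suc j) (s≤s z≤n))
    (ℕP.≮⇒≥ (λ lt → subst T a<b (ℕP.<⇒<ᵇ lt)))
ascents≡0⇒decreasing (a Vec.∷ b Vec.∷ v) eq (Fin.suc i) (Fin.suc j) (s≤s i<j) | false =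
  ascents≡0⇒decreasing (b Vec.∷ v) eq i j i<j

-- If the ascent is at the front, the cut goes right after the first entry; otherwise the first
-- entry joins the run of the second.
ascents≡1⇒colouring : ∀ {k n} (v : Vec (Fin k) n) → ascentsᵛ v ≡ 1 → ∃ (Colouring v)
ascents≡1⇒colouring (a Vec.∷ b Vec.∷ v) eq with ascents≡1⇒colouring (b Vec.∷ v) | toℕ a <ᵇ toℕ b in a<b
... | IH | true = c , record { monotone = mono ; decreasing = dec }
  where
  c : Fin _ → Fin 2
  c Fin.zero    = Fin.zero
  c (Fin.suc _) = Fin.suc Fin.zero
  mono : ∀ i j → i Fin.< j → c i Fin.≤ c j
  mono Fin.zero    _           _ = z≤n
  mono (Fin.suc _) (Fin.suc _) _ = s≤s z≤n
  dec : ∀ i j → i Fin.< j → c i ≡ c j → lookup (a Vec.∷ b Vec.∷ v) j Fin.≤ lookup (a Vec.∷ b Vec.∷ v) i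
  dec Fin.zero    (Fin.suc j) _         ()
  dec (Fin.suc i) (Fin.suc j) (s≤s i<j) _ = ascents≡0⇒decreasing (b Vec.∷ v) (ℕP.suc-injective eq) i j i<j
... | IH | false with c₀ , col ← IH eq = c , record { monotone = mono ; decreasing = dec }
  where
  c : Fin _ → Fin 2
  c Fin.zero    = c₀ Fin.zero
  c (Fin.suc i) = c₀ i
  b≤a : b Fin.≤ a
  b≤a = ℕP.≮⇒≥ (λ lt → subst T a<b (ℕP.<⇒<ᵇ lt))
  mono : ∀ i j → i Fin.< j → c i Fin.≤ c j
  mono Fin.zero    (Fin.suc Fin.zero)    _ = ℕP.≤-refl
  mono Fin.zero    (Fin.suc (Fin.suc j)) _ = monotone col Fin.zero (Fin.suc j) (s≤s z≤n)
  mono (Fin.suc i) (Fin.suc j)   (s≤s i<j) = monotone col i j i<j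
  dec : ∀ i j → i Fin.< j → c i ≡ c j → lookup (a Vec.∷ b Vec.∷ v) j Fin.≤ lookup (a Vec.∷ b Vec.∷ v) i
  dec Fin.zero    (Fin.suc Fin.zero)    _ _ = b≤a
  dec Fin.zero    (Fin.suc (Fin.suc j)) _ e = ℕP.≤-trans (decreasing col Fin.zero (Fin.suc j) (s≤s z≤n) e) b≤a
  dec (Fin.suc i) (Fin.suc j)   (s≤s i<j) e = decreasing col i j i<j e

decreasing⇒ascents≡0 : ∀ {k n} (v : Vec (Fin k) n) →
  (∀ i j → i Fin.< j → lookup v j Fin.≤ lookup v i) → ascentsᵛ v ≡ 0
decreasing⇒ascents≡0 Vec.[] dec = refl
decreasing⇒ascents≡0 (a Vec.∷ Vec.[]) dec = refl
decreasing⇒ascents≡0 (a Vec.∷ b Vec.∷ v) dec with decreasing⇒ascents≡0 (b Vec.∷ v) | toℕ a <ᵇ toℕ b in a<b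
... | IH | true  = contradiction (dec Fin.zero (Fin.suc Fin.zero) (s≤s z≤n)) (ℕP.<⇒≱ (ℕP.<ᵇ⇒< _ _ (subst T (sym a<b) tt)))
... | IH | false = IH (λ i j i<j → dec (Fin.suc i) (Fin.suc j) (s≤s i<j))

-- An ascent forces the colour to rise. From there on all colours are maximal, so the rest is one
-- decreasing run.
colouring⇒ascents≤1 : ∀ {k n} (v : Vec (Fin k) n) c → Colouring v c → ascentsᵛ v ≤ 1
colouring⇒ascents≤1 Vec.[] c col = z≤n
colouring⇒ascents≤1 (a Vec.∷ Vec.[]) c col = z≤n
colouring⇒ascents≤1 (a Vec.∷ b Vec.∷ v) c col with colouring⇒ascents≤1 (b Vec.∷ v) | toℕ a <ᵇ toℕ b in a<b
... | IH | false = IH (c ∘ Fin.suc) (record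
  { monotone   = λ i j i<j → monotone col (Fin.suc i) (Fin.suc j) (s≤s i<j)
  ; decreasing = λ i j i<j → decreasing col (Fin.suc i) (Fin.suc j) (s≤s i<j) })
... | IH | true = s≤s (ℕP.≤-reflexive (decreasing⇒ascents≡0 (b Vec.∷ v) λ i j i<j →
    decreasing col (Fin.suc i) (Fin.suc j) (s≤s i<j) (trans (top i) (sym (top j)))))
  where
  c0<c1 : c Fin.zero Fin.< c (Fin.suc Fin.zero)
  c0<c1 = ℕP.≤∧≢⇒< (monotone col Fin.zero (Fin.suc Fin.zero) (s≤s z≤n)) λ eq →
    contradiction (decreasing col Fin.zero (Fin.suc Fin.zero) (s≤s z≤n) (FinP.toℕ-injective eq))
      (ℕP.<⇒≱ (ℕP.<ᵇ⇒< _ _ (subst T (sym a<b) tt)))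
  top : ∀ i → c (Fin.suc i) ≡ Fin.suc Fin.zero
  top Fin.zero = proj₂ (Fin2-<-bounds c0<c1)
  top (Fin.suc i) = proj₂ (Fin2-<-bounds (ℕP.<-≤-trans c0<c1 (monotone col (Fin.suc Fin.zero) (Fin.suc (Fin.suc i)) (s≤s (s≤s z≤n)))))

-- The Boolean tests behind `C′`

IsCycle : ∀ {n} → Vec (Fin n) n → Set
IsCycle {n} τ = ∀ x y → ∃ λ j → j < n × iter τ j x ≡ y

T-all : {A : Set} (p : A → Bool) (xs : List A) → T (all p xs) ⇔ (∀ x → x ∈ xs → T (p x))
T-all p xs = mk⇔ (λ t x x∈ → All.lookup (AllP.all⁺ p xs t) x∈) (λ h → AllP.all⁻ p (All.tabulate (λ {x} → h x)))

T-any : {A : Set} (p : A → Bool) (xs : List A) → T (any p xs) ⇔ (∃ λ x → x ∈ xs × T (p x))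
T-any p xs = mk⇔ (λ t → let _ , x∈ , px = find (AnyP.any⁻ p xs t) in _ , x∈ , px)
                 (λ { (x , x∈ , px) → AnyP.any⁺ p (lose x∈ px) })

module _ {n : ℕ} (τ : Vec (Fin n) n) where
  open Equivalence

  T-isPermᵇ : T (isPermᵇ τ) ⇔ IsPerm τ
  T-isPermᵇ = mk⇔
    (λ t i j → sound i j (to (T-all _ (allFin n)) (to (T-all _ (allFin n)) t i (∈-allFin i)) j (∈-allFin j)))
    (λ perm → from (T-all _ (allFin n)) λ i _ → from (T-all _ (allFin n)) λ j _ → complete perm i j)
    where
    sound : ∀ i j → T (⌊ i FinP.≟ j ⌋ ∨ not ⌊ lookup τ i FinP.≟ lookup τ j ⌋) → lookup τ i ≡ lookup τ j → i ≡ j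
    sound i j t eq with i FinP.≟ j | lookup τ i FinP.≟ lookup τ j
    ... | yes i≡j | _      = i≡j
    ... | no _    | no neq = contradiction eq neq
    complete : IsPerm τ → ∀ i j → T (⌊ i FinP.≟ j ⌋ ∨ not ⌊ lookup τ i FinP.≟ lookup τ j ⌋)
    complete perm i j with i FinP.≟ j | lookup τ i FinP.≟ lookup τ j
    ... | yes _  | _      = tt
    ... | no neq | yes eq = contradiction (perm i j eq) neq
    ... | no _   | no _   = tt

  T-isCyclicᵇ : T (isCyclicᵇ τ) ⇔ IsCycle τ
  T-isCyclicᵇ = mk⇔
    (λ t x y → sound x y (to (T-any _ (upTo n)) (to (T-all _ (allFin n)) (to (T-all _ (allFin n)) t x (∈-allFin x)) y (∈-allFin y))))
    (λ cycle → from (T-all _ (allFin n)) λ x _ → from (T-all _ (allFin n)) λ y _ → from (T-any _ (upTo n)) (complete (cycle x y)))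
    where
    sound : ∀ x y → (∃ λ j → j ∈ upTo n × T ⌊ iter τ j x FinP.≟ y ⌋) → ∃ λ j → j < n × iter τ j x ≡ y
    sound x y (j , j∈ , t) = j , ∈-upTo⁻ j∈ , toWitness t
    complete : ∀ {x y} → (∃ λ j → j < n × iter τ j x ≡ y) → ∃ λ j → j ∈ upTo n × T ⌊ iter τ j x FinP.≟ y ⌋
    complete (j , j<n , eq) = j , ∈-upTo⁺ j<n , fromWitness eq

record OneAscentCycle {n : ℕ} (τ : Vec (Fin n) n) : Set where
  field
    perm       : IsPerm τ
    cycle      : IsCycle τ
    one-ascent : ascentsᵛ τ ≡ 1

card-C′ : ∀ n → Card (OneAscentCycle {n}) (C′ n 2)
card-C′ n = card-bijection id pres (λ _ _ _ _ eq → eq) surj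
  (card-filter (λ τ → T? (test τ)) (allVecs-enumerates n n))
  where
  open Equivalence
  test : Vec (Fin n) n → Bool
  test τ = isPermᵇ τ ∧ isCyclicᵇ τ ∧ (ascents τ ≡ᵇ 1)
  pres : ∀ τ → T (test τ) → OneAscentCycle τ
  pres τ t with t₁ , t₂₃ ← to (T-∧ {isPermᵇ τ}) t with t₂ , t₃ ← to (T-∧ {isCyclicᵇ τ}) t₂₃ = record
    { perm = to (T-isPermᵇ τ) t₁ ; cycle = to (T-isCyclicᵇ τ) t₂ ; one-ascent = ℕP.≡ᵇ⇒≡ _ 1 t₃ }
  surj : ∀ τ → OneAscentCycle τ → ∃ λ x → T (test x) × x ≡ τ
  surj τ o = τ , from (T-∧ {isPermᵇ τ}) (from (T-isPermᵇ τ) perm ,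
    from (T-∧ {isCyclicᵇ τ}) (from (T-isCyclicᵇ τ) cycle , ℕP.≡⇒≡ᵇ _ 1 one-ascent)) , refl
    where open OneAscentCycle o

-- Cycles with a starting point as orderings

-- A section of `f` is injective, hence surjective, hence a two-sided inverse.
surjective⇒injective : ∀ {n} (f : Fin n → Fin n) → (∀ y → ∃ λ x → f x ≡ y) → ∀ i j → f i ≡ f j → i ≡ j
surjective⇒injective f surj i j eq = begin
  i               ≡⟨ sym (section∘f i) ⟩
  section (f i)   ≡⟨ cong section eq ⟩
  section (f j)   ≡⟨ section∘f j ⟩
  j               ∎
  where
  open ≡-Reasoning
  section : Fin _ → Fin _
  section y = proj₁ (surj y)
  section-injective : ∀ y z → section y ≡ section z → y ≡ z
  section-injective y z e = trans (sym (proj₂ (surj y))) (trans (cong f e) (proj₂ (surj z)))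
  section∘f : ∀ i → section (f i) ≡ i
  section∘f i with y , refl ← injective⇒surjective section section-injective i = cong section (proj₂ (surj y))

module Orbit {n : ℕ} .{{_ : NonZero n}} (τ : Vec (Fin n) n) (perm : IsPerm τ) (cycle : IsCycle τ) (x : Fin n) where

  orbit : ℕ → Fin n
  orbit i = iter τ i x

  orbit-injective : ∀ i j → i < n → j < n → orbit i ≡ orbit j → i ≡ j
  orbit-injective i j i<n j<n eq = begin
    i                    ≡⟨ sym (FinP.toℕ-fromℕ< i<n) ⟩
    toℕ (fromℕ< i<n)     ≡⟨ cong toℕ (surjective⇒injective (orbit ∘ toℕ) surj _ _ (subst₂ (λ a b → orbit a ≡ orbit b) (sym (FinP.toℕ-fromℕ< i<n)) (sym (FinP.toℕ-fromℕ< j<n)) eq)) ⟩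
    toℕ (fromℕ< j<n)     ≡⟨ FinP.toℕ-fromℕ< j<n ⟩
    j                    ∎
    where
    open ≡-Reasoning
    surj : ∀ y → ∃ λ k → orbit (toℕ k) ≡ y
    surj y with k , k<n , eq ← cycle x y = fromℕ< k<n , trans (cong orbit (FinP.toℕ-fromℕ< k<n)) eq

  -- The point reached after `n` steps was already met at some time below `n`. Were that time
  -- positive, injectivity of `τ` would give a repetition one step earlier, among the first `n`
  -- points.
  orbit-returns : orbit n ≡ x
  orbit-returns with cycle x (orbit n)
  ... | zero  , _   , eq = sym eq
  ... | suc j , j<n , eq = contradiction
    (orbit-injective j (pred n) (ℕP.<-trans (ℕP.n<1+n j) j<n) (subst (pred n <_) (ℕP.suc-pred n) (ℕP.n<1+n _))
      (perm _ _ (trans eq (cong orbit (sym (ℕP.suc-pred n))))))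
    (λ j≡ → ℕP.<-irrefl (trans (cong suc j≡) (ℕP.suc-pred n)) j<n)

  orbit-period : Period n orbit
  orbit-period zero    = trans (cong orbit (ℕP.+-identityʳ n)) orbit-returns
  orbit-period (suc i) = trans (cong orbit (ℕP.+-suc n i)) (cong (lookup τ) (orbit-period i))

module _ {n : ℕ} .{{_ : NonZero n}} where

  -- The cycle notation of `τ`, begun at `x` and read as one-line notation. The choice of `x`
  -- accounts for the factor `n` in the counts.
  orbitVec : Vec (Fin n) n × Fin n → Vec (Fin n) n
  orbitVec (τ , x) = Vec.tabulate (λ i → iter τ (toℕ i) x)

  cyc-orbitVec : ∀ τ x → IsPerm τ → IsCycle τ → ∀ i → cyc (orbitVec (τ , x)) i ≡ iter τ i x
  cyc-orbitVec τ x p c = cyc-tabulate (λ i → iter τ i x) (Orbit.orbit-period τ p c x)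

  orbitVec-perm : ∀ τ x → IsPerm τ → IsCycle τ → IsPerm (orbitVec (τ , x))
  orbitVec-perm τ x p c i j eq = FinP.toℕ-injective
    (Orbit.orbit-injective τ p c x (toℕ i) (toℕ j) (FinP.toℕ<n i) (FinP.toℕ<n j)
      (trans (sym (VecP.lookup∘tabulate _ i)) (trans eq (VecP.lookup∘tabulate _ j))))

  orbitVec-injective : ∀ y z → IsPerm (proj₁ y) → IsCycle (proj₁ y) → IsPerm (proj₁ z) → IsCycle (proj₁ z) →
    orbitVec y ≡ orbitVec z → y ≡ z
  orbitVec-injective (τ , x) (τ′ , x′) p c p′ c′ eq = cong₂ _,_ τ≡ (same 0)
    where
    same : ∀ i → iter τ i x ≡ iter τ′ i x′
    same i = trans (sym (cyc-orbitVec τ x p c i)) (trans (cong (λ v → cyc v i) eq) (cyc-orbitVec τ′ x′ p′ c′ i))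
    lookup≡ : ∀ y → lookup τ y ≡ lookup τ′ y
    lookup≡ y with j , _ , refl ← c x y = trans (same (suc j)) (cong (lookup τ′) (sym (same j)))
    τ≡ : τ ≡ τ′
    τ≡ = trans (sym (VecP.tabulate∘lookup τ)) (trans (VecP.tabulate-cong lookup≡) (VecP.tabulate∘lookup τ′))

  Next : Vec (Fin n) n → Vec (Fin n) n → Set
  Next τ π = ∀ i → lookup τ (cyc π i) ≡ cyc π (suc i)

  next-< : ∀ τ π → IsPerm π → Next τ π → ∀ i j → pos π i < pos π j →
    lookup τ (cyc π j) Fin.≤ lookup τ (cyc π i) → pos π (suc j) < pos π (suc i)
  next-< τ π p next i j lt le = ℕP.≤∧≢⇒< (subst₂ Fin._≤_ (next j) (next i) le) λ eq →
    ℕP.<-irrefl (period-cong (period C) {i} {j} (sym (%-pred {n} _ _ (injective C (suc j) (suc i) eq)))) lt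
    where
    C = pos-cyclic π p

  -- The word records the colours met along the cycle: monotonicity of the colouring gives
  -- `letters`, and decrease within a run gives `reverses`.
  oneAscent⇒ordering : ∀ τ π → IsPerm π → Next τ π → ascentsᵛ τ ≡ 1 → Ordering n π
  oneAscent⇒ordering τ π p next asc with c , col ← ascents≡1⇒colouring τ asc =
    p , c ∘ cyc π , (λ i → cong c (cyc-period π i)) , record { letters = lett ; reverses = rev }
    where
    lett : ∀ i j → c (cyc π i) Fin.< c (cyc π j) → pos π i < pos π j
    lett i j lt with FinP.<-cmp (cyc π i) (cyc π j)
    ... | tri< l _ _ = l
    ... | tri≈ _ e _ = contradiction lt (ℕP.<-irrefl (cong (toℕ ∘ c) e))
    ... | tri> _ _ g = contradiction lt (ℕP.≤⇒≯ (monotone col _ _ g))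
    rev : ∀ i j → c (cyc π i) ≡ c (cyc π j) → pos π i < pos π j → pos π (suc j) < pos π (suc i)
    rev i j eq lt = next-< τ π p next i j lt (decreasing col _ _ lt eq)

  module Successor (π : Vec (Fin n) n) (p : IsPerm π) where

    index : Fin n → ℕ
    index y = toℕ (proj₁ (injective⇒surjective (lookup π) p y))

    cyc-index : ∀ y → cyc π (index y) ≡ y
    cyc-index y = trans (cyc-toℕ π _) (proj₂ (injective⇒surjective (lookup π) p y))

    successor : Vec (Fin n) n
    successor = Vec.tabulate (λ y → cyc π (suc (index y)))

    index-% : ∀ i → index (cyc π i) % n ≡ i % n
    index-% i = injective (pos-cyclic π p) _ i (cong toℕ (cyc-index (cyc π i)))

    next : Next successor π
    next i = trans (VecP.lookup∘tabulate _ (cyc π i))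
      (period-cong (cyc-period π) {suc (index (cyc π i))} {suc i} (suc-%-cong (index (cyc π i)) i (index-% i)))

    iter-successor : ∀ k i → iter successor k (cyc π i) ≡ cyc π (k + i)
    iter-successor zero    i = refl
    iter-successor (suc k) i = trans (cong (lookup successor) (iter-successor k i)) (next (k + i))

    successor-perm : IsPerm successor
    successor-perm x y eq = begin
      x                      ≡⟨ sym (cyc-index x) ⟩
      cyc π (index x)        ≡⟨ period-cong (cyc-period π) {index x} {index y} (%-pred {n} _ _ (injective (pos-cyclic π p) _ _ (cong toℕ shifted))) ⟩
      cyc π (index y)        ≡⟨ cyc-index y ⟩
      y                      ∎
      where
      open ≡-Reasoning
      shifted : cyc π (suc (index x)) ≡ cyc π (suc (index y))
      shifted = trans (sym (VecP.lookup∘tabulate _ x)) (trans eq (VecP.lookup∘tabulate _ y))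

    successor-cycle : IsCycle successor
    successor-cycle x y = k , m%n<n _ n , (begin
      iter successor k x                   ≡⟨ cong (iter successor k) (sym (cyc-index x)) ⟩
      iter successor k (cyc π (index x))   ≡⟨ iter-successor k (index x) ⟩
      cyc π (k + index x)                  ≡⟨ period-cong (cyc-period π) {k + index x} {index y} k+x ⟩
      cyc π (index y)                      ≡⟨ cyc-index y ⟩
      y                                    ∎)
      where
      open ≡-Reasoning
      k : ℕ
      -- The number of steps from `x` to `y`; the summand `n` keeps the difference of the indices
      -- nonnegative.
      k = (index y + (n ∸ index x)) % n
      k+x : (k + index x) % n ≡ index y % n
      k+x = begin
        (k + index x) % n                              ≡⟨ %-distribˡ-+ k (index x) n ⟩
        (k % n + index x % n) % n                      ≡⟨ cong (λ t → (t + index x % n) % n) (m%n%n≡m%n (index y + (n ∸ index x)) n) ⟩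
        (k + index x % n) % n                          ≡⟨ sym (%-distribˡ-+ (index y + (n ∸ index x)) (index x) n) ⟩
        (index y + (n ∸ index x) + index x) % n        ≡⟨ cong (_% n) (ℕP.+-assoc (index y) (n ∸ index x) (index x)) ⟩
        (index y + (n ∸ index x + index x)) % n        ≡⟨ cong (λ t → (index y + t) % n) (ℕP.m∸n+n≡m (ℕP.<⇒≤ (FinP.toℕ<n (proj₁ (injective⇒surjective (lookup π) p x))))) ⟩
        (index y + n) % n                              ≡⟨ [m+n]%n≡m%n (index y) n ⟩
        index y % n                                    ∎

    orbitVec-successor : orbitVec (successor , cyc π 0) ≡ π
    orbitVec-successor = trans
      (VecP.tabulate-cong λ i → trans (iter-successor (toℕ i) 0)
        (trans (cong (cyc π) (ℕP.+-identityʳ (toℕ i))) (cyc-toℕ π i)))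
      (VecP.tabulate∘lookup π)

    -- The letters of the word colour the positions, which allows at most one ascent. With no ascent
    -- the shift would reverse the whole order, and `n` would divide 2.
    successor-ascents : 3 ≤ n → ∀ {s} → Compatible s (pos π) → ascentsᵛ successor ≡ 1
    successor-ascents 3≤n {s} c = ℕP.≤-antisym
      (colouring⇒ascents≤1 successor (s ∘ index) (record { monotone = mono ; decreasing = dec }))
      (ℕP.n≢0⇒n>0 λ asc≡0 → contradiction
        (∣⇒≤ (decreasing⇒∣2 (pos-cyclic π p) λ i j lt →
          next-< successor π p next i j lt (ascents≡0⇒decreasing successor asc≡0 _ _ lt)))
        (ℕP.<⇒≱ 3≤n))
      where
      pos-index : ∀ y → pos π (index y) ≡ toℕ y
      pos-index y = cong toℕ (cyc-index y)
      mono : ∀ x y → x Fin.< y → s (index x) Fin.≤ s (index y)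
      mono x y x<y = ℕP.≮⇒≥ λ lt → ℕP.<⇒≯ x<y (subst₂ _<_ (pos-index y) (pos-index x) (letters c _ _ lt))
      dec : ∀ x y → x Fin.< y → s (index x) ≡ s (index y) → lookup successor y Fin.≤ lookup successor x
      dec x y x<y eq = subst₂ Fin._≤_ (sym (VecP.lookup∘tabulate _ y)) (sym (VecP.lookup∘tabulate _ x))
        (ℕP.<⇒≤ (reverses c (index x) (index y) eq (subst₂ _<_ (sym (pos-index x)) (sym (pos-index y)) x<y)))

card-ordering : ∀ n .{{_ : NonZero n}} → 3 ≤ n → Card (Ordering n) (C′ n 2 * n)
card-ordering n 3≤n = card-bijection orbitVec pres inj surj (card-×Fin n (card-C′ n))
  where
  open OneAscentCycle
  pres : ∀ y → OneAscentCycle (proj₁ y) → Ordering n (orbitVec y)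
  pres (τ , x) o = oneAscent⇒ordering τ (orbitVec (τ , x)) (orbitVec-perm τ x (perm o) (cycle o))
    (λ i → trans (cong (lookup τ) (cyc-orbitVec τ x (perm o) (cycle o) i))
             (sym (cyc-orbitVec τ x (perm o) (cycle o) (suc i))))
    (one-ascent o)
  inj : ∀ y z → OneAscentCycle (proj₁ y) → OneAscentCycle (proj₁ z) → orbitVec y ≡ orbitVec z → y ≡ z
  inj y z o o′ = orbitVec-injective y z (perm o) (cycle o) (perm o′) (cycle o′)
  surj : ∀ π → Ordering n π → ∃ λ y → OneAscentCycle (proj₁ y) × orbitVec y ≡ π
  surj π (p , s , per , c) = (successor , cyc π 0) ,
    record { perm = successor-perm ; cycle = successor-cycle ; one-ascent = successor-ascents 3≤n c } ,
    orbitVec-successor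
    where open Successor π p

-- Patterns of primitive words

prefix-cong : ∀ {k} n {s t : Word k} → (∀ i → s i ≡ t i) → prefix n s ≡ prefix n t
prefix-cong n eq = ListP.tabulate-cong (λ i → eq (toℕ i))

prefix-+ : ∀ {k} a b (s : Word k) → prefix (a + b) s ≡ prefix a s ++ prefix b (shiftBy a s)
prefix-+ zero    b s = refl
prefix-+ (suc a) b s = cong (s 0 ∷_) (prefix-+ a b (s ∘ suc))

prefix-injective : ∀ {k} n (s t : Word k) → prefix n s ≡ prefix n t → ∀ i → i < n → s i ≡ t i
prefix-injective (suc n) s t eq zero    _         = ListP.∷-injectiveˡ eq
prefix-injective (suc n) s t eq (suc i) (s≤s i<n) = prefix-injective n (s ∘ suc) (t ∘ suc) (ListP.∷-injectiveʳ eq) i i<n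

prefix-power : ∀ {k} r d (s : Word k) → Period d s → prefix (r * d) s ≡ concat (replicate r (prefix d s))
prefix-power zero    d s per = refl
prefix-power (suc r) d s per = trans (prefix-+ d (r * d) s)
  (cong (prefix d s ++_) (trans (prefix-cong (r * d) per) (prefix-power r d s per)))

++-injective : {A : Set} (xs ys : List A) {us vs : List A} → length xs ≡ length ys →
  xs ++ us ≡ ys ++ vs → xs ≡ ys × us ≡ vs
++-injective []       []       _  eq = refl , eq
++-injective (x ∷ xs) (y ∷ ys) le eq with refl , eq′ ← ListP.∷-injective eq
  with refl , eq″ ← ++-injective xs ys (ℕP.suc-injective le) eq′ = refl , eq″

length-power : {A : Set} (r : ℕ) (v : List A) → length (concat (replicate r v)) ≡ r * length v
length-power zero    v = refl
length-power (suc r) v = trans (ListP.length-++ v) (cong (length v +_) (length-power r v))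

power-blocks : ∀ {k} r (v : List (Fin k)) (s : Word k) → prefix (r * length v) s ≡ concat (replicate r v) →
  ∀ b → b < r → prefix (length v) (shiftBy (b * length v) s) ≡ v
power-blocks (suc r) v s eq b b<r
  with first , rest ← ++-injective (prefix (length v) s) v (ListP.length-tabulate _)
                        (trans (sym (prefix-+ (length v) (r * length v) s)) eq)
  with b | b<r
... | zero   | _        = first
... | suc b′ | s≤s b′<r = trans
  (prefix-cong (length v) (λ i → cong s (ℕP.+-assoc (length v) (b′ * length v) i)))
  (power-blocks r v (shiftBy (length v) s) rest b′ b′<r)

-- The equation of lists controls the first `n` letters only. Comparison with `s (x % p)`, which
-- also has period `n`, extends it to all indices.
power⇒period : ∀ {k n} .{{_ : NonZero n}} {s : Word k} r v → Period n s →
  prefix n s ≡ concat (replicate r v) → n ≡ r * length v × Period (length v) s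
power⇒period {k} {n} {s} r v per eq = n≡ , period′ (ℕP.m*n≢0⇒n≢0 r {{subst NonZero n≡ it}})
  where
  p : ℕ
  p = length v
  n≡ : n ≡ r * p
  n≡ = trans (sym (ListP.length-tabulate {n = n} (s ∘ toℕ))) (trans (cong length eq) (length-power r v))
  blocks : ∀ b → b < r → prefix p (shiftBy (b * p) s) ≡ v
  blocks = power-blocks r v s (subst (λ t → prefix t s ≡ concat (replicate r v)) n≡ eq)
  module _ (p≢0 : NonZero p) where
    instance _ = p≢0
    residue : ℕ → Fin k
    residue x = s (x % p)
    residue-period : Period p residue
    residue-period x = cong s (%-remove-+ˡ {p} x {p} ∣-refl)
    s≡residue : ∀ x → s x ≡ residue x
    s≡residue = periodic-ext per (period-∣ (divides r n≡) residue-period) λ x x<n → begin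
      s x                      ≡⟨ cong s (trans (m≡m%n+[m/n]*n x p) (ℕP.+-comm (x % p) _)) ⟩
      s (x / p * p + x % p)    ≡⟨ prefix-injective p (shiftBy (x / p * p) s) s
                                    (trans (blocks (x / p) (m<n*o⇒m/o<n (subst (x <_) n≡ x<n)))
                                      (sym (blocks 0 (r>0 x<n)))) (x % p) (m%n<n x p) ⟩
      s (x % p)                ∎
      where
      open ≡-Reasoning
      r>0 : ∀ {x} → x < n → 0 < r
      r>0 x<n = ℕP.n≢0⇒n>0 λ { refl → contradiction (subst (_ <_) n≡ x<n) λ () }
    period′ : Period p s
    period′ x = trans (s≡residue (p + x)) (trans (residue-period x) (sym (s≡residue x)))

module _ {n : ℕ} .{{_ : NonZero n}} {s : ℕ → Fin 2} where

  prim⇒InW : Prim n s → InW 2 n s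
  prim⇒InW (per , prim) = per , λ { (v , r , 2≤r , eq) → proper v r 2≤r (power⇒period r v per eq) }
    where
    proper : ∀ v r → 2 ≤ r → n ≡ r * length v × Period (length v) s → ⊥
    proper v r 2≤r (n≡ , perv) = ℕP.<⇒≱ v<n (∣⇒≤ {{p≢0}} (prim (length v) perv))
      where
      p≢0 : NonZero (length v)
      p≢0 = ℕP.m*n≢0⇒n≢0 r {{subst NonZero n≡ it}}
      v<n : length v < n
      v<n = subst (length v <_) (trans (ℕP.*-comm (length v) r) (sym n≡)) (ℕP.m<m*n (length v) r {{p≢0}} 2≤r)

  -- For a period `p`, the gcd of `p` and `n` is a period too. If it were a proper divisor of `n`,
  -- the word would be a proper power; so it equals `n` and divides `p`.
  InW⇒prim : InW 2 n s → Prim n s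
  InW⇒prim (per , irreducible) = per , divide
    where
    divide : ∀ p → Period p s → n ∣ p
    divide p perp with Bézout.lemma p n
    ... | Bézout.result d gcd _ with GCD.GCD.commonDivisor gcd
    ... | d∣p , divides zero          n≡ = contradiction n≡ (ℕ.≢-nonZero⁻¹ n)
    ... | d∣p , divides (suc zero)    n≡ = subst (_∣ p) (sym (trans n≡ (ℕP.+-identityʳ d))) d∣p
    ... | d∣p , divides (suc (suc r)) n≡ = contradiction
      (prefix d s , suc (suc r) , s≤s (s≤s z≤n) ,
       trans (cong (λ t → prefix t s) n≡) (prefix-power (suc (suc r)) d s (period-gcd gcd perp per)))
      irreducible

-- The order of the reverse shift as an alternating order

_≺_ : Word 2 → Word 2 → Set
s ≺ t = s ≺[ reverseSigns 2 ] t

minusCount-reverse : ∀ (s : Word 2) j → minusCount (reverseSigns 2) s j ≡ j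
minusCount-reverse s zero    = refl
minusCount-reverse s (suc j) = trans (ℕP.+-comm _ 1) (cong suc (minusCount-reverse s j))

suc%2 : ∀ d → (suc d % 2 ≡ 0 → d % 2 ≡ 1) × (suc d % 2 ≡ 1 → d % 2 ≡ 0)
suc%2 zero          = (λ ()) , λ _ → refl
suc%2 (suc zero)    = (λ _ → refl) , λ ()
suc%2 (suc (suc d)) = suc%2 d

%2-suc : ∀ d → (d % 2 ≡ 1 → suc d % 2 ≡ 0) × (d % 2 ≡ 0 → suc d % 2 ≡ 1)
%2-suc zero          = (λ ()) , λ _ → refl
%2-suc (suc zero)    = (λ _ → refl) , λ ()
%2-suc (suc (suc d)) = %2-suc d

module _ (s : ℕ → Fin 2) where

  -- The body of `≺` for all signs minus, where the count of minus signs is the index itself.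
  -- `FirstDiff` expresses the same by exchanging its arguments instead of tracking a parity.
  DiffersAt : ℕ → ℕ → ℕ → Set
  DiffersAt d i j = (∀ x → x < d → s (i + x) ≡ s (j + x)) ×
    ((d % 2 ≡ 0 × s (i + d) Fin.< s (j + d)) ⊎ (d % 2 ≡ 1 × s (j + d) Fin.< s (i + d)))

  differsAt⇒firstDiff : ∀ d i j → DiffersAt d i j → FirstDiff s d i j
  differsAt⇒firstDiff zero i j (_ , inj₁ (_ , lt)) =
    subst₂ (λ a b → s a Fin.< s b) (ℕP.+-identityʳ i) (ℕP.+-identityʳ j) lt
  differsAt⇒firstDiff (suc d) i j (agree , diff) =
    subst₂ (λ a b → s a ≡ s b) (ℕP.+-identityʳ i) (ℕP.+-identityʳ j) (agree 0 (s≤s z≤n)) ,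
    differsAt⇒firstDiff d (suc j) (suc i)
      ((λ x x<d → subst₂ (λ a b → s a ≡ s b) (ℕP.+-suc j x) (ℕP.+-suc i x) (sym (agree (suc x) (s≤s x<d)))) ,
       shift diff)
    where
    shift : _ → _
    shift (inj₁ (e , lt)) = inj₂ (proj₁ (suc%2 d) e , subst₂ (λ a b → s a Fin.< s b) (ℕP.+-suc i d) (ℕP.+-suc j d) lt)
    shift (inj₂ (e , lt)) = inj₁ (proj₂ (suc%2 d) e , subst₂ (λ a b → s a Fin.< s b) (ℕP.+-suc j d) (ℕP.+-suc i d) lt)

  firstDiff⇒differsAt : ∀ d i j → FirstDiff s d i j → DiffersAt d i j
  firstDiff⇒differsAt zero i j lt = (λ _ ()) ,
    inj₁ (refl , subst₂ (λ a b → s a Fin.< s b) (sym (ℕP.+-identityʳ i)) (sym (ℕP.+-identityʳ j)) lt)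
  firstDiff⇒differsAt (suc d) i j (eq , fd) with agree , diff ← firstDiff⇒differsAt d (suc j) (suc i) fd =
    (λ { zero    _         → subst₂ (λ a b → s a ≡ s b) (sym (ℕP.+-identityʳ i)) (sym (ℕP.+-identityʳ j)) eq
       ; (suc x) (s≤s x<d) → subst₂ (λ a b → s a ≡ s b) (sym (ℕP.+-suc i x)) (sym (ℕP.+-suc j x)) (sym (agree x x<d)) }) ,
    shift diff
    where
    shift : _ → _
    shift (inj₁ (e , lt)) = inj₂ (proj₂ (%2-suc d) e , subst₂ (λ a b → s a Fin.< s b) (sym (ℕP.+-suc j d)) (sym (ℕP.+-suc i d)) lt)
    shift (inj₂ (e , lt)) = inj₁ (proj₁ (%2-suc d) e , subst₂ (λ a b → s a Fin.< s b) (sym (ℕP.+-suc i d)) (sym (ℕP.+-suc j d)) lt)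

  ≺⇒firstDiff : ∀ i j → shiftBy i s ≺ shiftBy j s → ∃ λ d → FirstDiff s d i j
  ≺⇒firstDiff i j (d , agree , diff) rewrite minusCount-reverse (shiftBy i s) d =
    d , differsAt⇒firstDiff d i j (agree , diff)

  firstDiff⇒≺ : ∀ i j d → FirstDiff s d i j → shiftBy i s ≺ shiftBy j s
  firstDiff⇒≺ i j d fd with agree , diff ← firstDiff⇒differsAt d i j fd =
    d , agree , subst (λ m → (m % 2 ≡ 0 × s (i + d) Fin.< s (j + d)) ⊎ (m % 2 ≡ 1 × s (j + d) Fin.< s (i + d)))
                  (sym (minusCount-reverse (shiftBy i s) d)) diff

firstDiff-cong : ∀ {n} .{{_ : NonZero n}} {s} → Period n s → ∀ d {i i′ j j′} → i % n ≡ i′ % n → j % n ≡ j′ % n →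
  FirstDiff s d i j → FirstDiff s d i′ j′
firstDiff-cong per zero    i≡ j≡ lt = subst₂ Fin._<_ (period-cong per i≡) (period-cong per j≡) lt
firstDiff-cong per (suc d) {i} {i′} {j} {j′} i≡ j≡ (eq , fd) =
  trans (sym (period-cong per i≡)) (trans eq (period-cong per j≡)) ,
  firstDiff-cong per d (suc-%-cong j j′ j≡) (suc-%-cong i i′ i≡) fd

module _ {n : ℕ} .{{_ : NonZero n}} {s : ℕ → Fin 2} (π : Vec (Fin n) n) where

  compatible⇒pattern : Prim n s → IsPerm π → Compatible s (pos π) → IsPattern (reverseSigns 2) s π
  compatible⇒pattern prim p c = p , λ i j → mk⇔
    (λ lt → before⇒≺ i j (subst₂ Fin._<_ (sym (cyc-toℕ π i)) (sym (cyc-toℕ π j)) lt))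
    (λ ≺ → let d , fd = ≺⇒firstDiff s (toℕ i) (toℕ j) ≺ in
       subst₂ Fin._<_ (cyc-toℕ π i) (cyc-toℕ π j) (firstDiff⇒< C c d (toℕ i) (toℕ j) fd))
    where
    C = pos-cyclic π p
    before⇒≺ : ∀ i j → pos π (toℕ i) < pos π (toℕ j) → shiftBy (toℕ i) s ≺ shiftBy (toℕ j) s
    before⇒≺ i j lt with compare (proj₁ prim) (toℕ i) (toℕ j)
    ... | before d _ fd = firstDiff⇒≺ s (toℕ i) (toℕ j) d fd
    ... | after  d _ fd = contradiction (firstDiff⇒< C c d (toℕ j) (toℕ i) fd) (ℕP.<⇒≯ lt)
    ... | tied tie      = contradiction lt
      (ℕP.<-irrefl (period-cong (period C) {toℕ i} {toℕ j} (tie-primitive prim (toℕ i) (toℕ j) tie)))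

  pattern⇒compatible : Period n s → IsPattern (reverseSigns 2) s π → Compatible s (pos π)
  pattern⇒compatible per (p , iff) = record
    { letters  = λ i j lt → firstDiff⇒pos< 0 i j lt
    ; reverses = rev
    }
    where
    open Equivalence
    toℕ-mod-% : ∀ i → toℕ (i mod n) % n ≡ i % n
    toℕ-mod-% i = trans (cong (_% n) (toℕ-mod i)) (m%n%n≡m%n i n)
    firstDiff⇒pos< : ∀ d i j → FirstDiff s d i j → pos π i < pos π j
    firstDiff⇒pos< d i j fd = from (iff (i mod n) (j mod n)) (firstDiff⇒≺ s _ _ d
      (firstDiff-cong per d (sym (toℕ-mod-% i)) (sym (toℕ-mod-% j)) fd))
    pos<⇒firstDiff : ∀ i j → pos π i < pos π j → ∃ λ d → FirstDiff s d i j
    pos<⇒firstDiff i j lt with d , fd ← ≺⇒firstDiff s _ _ (to (iff (i mod n) (j mod n)) lt) =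
      d , firstDiff-cong per d (toℕ-mod-% i) (toℕ-mod-% j) fd
    rev : ∀ i j → s i ≡ s j → pos π i < pos π j → pos π (suc j) < pos π (suc i)
    rev i j eq lt with pos<⇒firstDiff i j lt
    ... | zero  , s<       = contradiction s< (ℕP.<-irrefl (cong toℕ eq))
    ... | suc d , (_ , fd) = firstDiff⇒pos< d (suc j) (suc i) fd

card-InP : ∀ n .{{_ : NonZero n}} → 3 ≤ n → Card (InP (reverseSigns 2) n) (primCount n)
card-InP n 3≤n = card-bijection primPattern pres (primPattern-injective 3≤n) surj (card-primitive n)
  where
  pres : ∀ w → IsPrim n w → InP (reverseSigns 2) n (primPattern w)
  pres w pw = cyc w , prim⇒InW pw , compatible⇒pattern (primPattern w) pw perm compatible
    where open Pattern (cyc-period w) (primitive-tiebreak pw)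
  surj : ∀ π → InP (reverseSigns 2) n π → ∃ λ w → IsPrim n w × primPattern w ≡ π
  surj π (s , inW , pat) = primPattern-surjective π (proj₁ pat)
    (pattern⇒compatible π (proj₁ inW) pat) (InW⇒prim inW)

-- Integer sums

-- The Iverson bracket.
⟦_⟧ : {P : Set} → Dec P → ℤ
⟦ yes _ ⟧ = ℤ.+ 1
⟦ no _ ⟧  = ℤ.+ 0

⟦⟧-cong : {P Q : Set} (P? : Dec P) (Q? : Dec Q) → (P → Q) → (Q → P) → ⟦ P? ⟧ ≡ ⟦ Q? ⟧
⟦⟧-cong (yes _) (yes _) _ _ = refl
⟦⟧-cong (yes p) (no ¬q) f _ = contradiction (f p) ¬q
⟦⟧-cong (no ¬p) (yes q) _ g = contradiction (g q) ¬p
⟦⟧-cong (no _)  (no _)  _ _ = refl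

⟦⟧-yes : {P : Set} (P? : Dec P) → P → ⟦ P? ⟧ ≡ ℤ.+ 1
⟦⟧-yes (yes _) _ = refl
⟦⟧-yes (no ¬p) p = contradiction p ¬p

⟦⟧-no : {P : Set} (P? : Dec P) → ¬ P → ⟦ P? ⟧ ≡ ℤ.+ 0
⟦⟧-no (yes p) ¬p = contradiction p ¬p
⟦⟧-no (no _)  _  = refl

∑ : {A : Set} → List A → (A → ℤ) → ℤ
∑ xs f = List.foldr ℤ._+_ (ℤ.+ 0) (map f xs)

module _ {A : Set} where

  ∑-cong : (xs : List A) {f g : A → ℤ} → (∀ x → x ∈ xs → f x ≡ g x) → ∑ xs f ≡ ∑ xs g
  ∑-cong []       eq = refl
  ∑-cong (x ∷ xs) eq = cong₂ ℤ._+_ (eq x (here refl)) (∑-cong xs (λ y y∈ → eq y (there y∈)))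

  ∑-0 : (xs : List A) {f : A → ℤ} → (∀ x → x ∈ xs → f x ≡ ℤ.+ 0) → ∑ xs f ≡ ℤ.+ 0
  ∑-0 []       eq = refl
  ∑-0 (x ∷ xs) eq = cong₂ ℤ._+_ (eq x (here refl)) (∑-0 xs (λ y y∈ → eq y (there y∈)))

  ∑-+ : (xs : List A) (f g : A → ℤ) → ∑ xs (λ x → f x ℤ.+ g x) ≡ ∑ xs f ℤ.+ ∑ xs g
  ∑-+ []       f g = refl
  ∑-+ (x ∷ xs) f g = begin
    f x ℤ.+ g x ℤ.+ ∑ xs (λ y → f y ℤ.+ g y)       ≡⟨ cong (λ t → f x ℤ.+ g x ℤ.+ t) (∑-+ xs f g) ⟩
    f x ℤ.+ g x ℤ.+ (∑ xs f ℤ.+ ∑ xs g)            ≡⟨ interchange (f x) (g x) (∑ xs f) (∑ xs g) ⟩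
    f x ℤ.+ ∑ xs f ℤ.+ (g x ℤ.+ ∑ xs g)            ∎
    where
    open ≡-Reasoning
    open import Algebra.Properties.CommutativeSemigroup ℤP.+-commutativeSemigroup using (interchange)

  ∑-*ˡ : (xs : List A) (c : ℤ) (f : A → ℤ) → ∑ xs (λ x → c ℤ.* f x) ≡ c ℤ.* ∑ xs f
  ∑-*ˡ []       c f = sym (ℤP.*-zeroʳ c)
  ∑-*ˡ (x ∷ xs) c f = trans (cong (λ t → c ℤ.* f x ℤ.+ t) (∑-*ˡ xs c f)) (sym (ℤP.*-distribˡ-+ c (f x) (∑ xs f)))

  ∑-single : (xs : List A) {f : A → ℤ} {x : A} → Unique xs → x ∈ xs →
    (∀ y → y ∈ xs → y ≢ x → f y ≡ ℤ.+ 0) → ∑ xs f ≡ f x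
  ∑-single (x ∷ xs) {f} (x∉ ∷ _) (here refl) others≡0 = trans
    (cong (λ t → f x ℤ.+ t) (∑-0 xs λ y y∈ → others≡0 y (there y∈) λ { refl → All.lookup x∉ y∈ refl }))
    (ℤP.+-identityʳ (f x))
  ∑-single (y ∷ xs) {f} (y∉ ∷ u) (there x∈) others≡0 = trans
    (cong₂ ℤ._+_ (others≡0 y (here refl) λ { refl → All.lookup y∉ x∈ refl })
      (∑-single xs u x∈ (λ z z∈ → others≡0 z (there z∈))))
    (ℤP.+-identityˡ _)

  length-filter≡∑ : {P : A → Set} (P? : ∀ x → Dec (P x)) (xs : List A) →
    ℤ.+ length (filter P? xs) ≡ ∑ xs (λ x → ⟦ P? x ⟧)
  length-filter≡∑ P? [] = refl
  length-filter≡∑ P? (x ∷ xs) with P? x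
  ... | yes _ = trans (ℤP.pos-+ 1 (length (filter P? xs))) (cong (λ t → ℤ.+ 1 ℤ.+ t) (length-filter≡∑ P? xs))
  ... | no _  = trans (length-filter≡∑ P? xs) (sym (ℤP.+-identityˡ _))

  ∑-filterᵇ : {P : A → Set} (P? : ∀ x → Dec (P x)) (xs : List A) (f : A → ℤ) →
    ∑ (filterᵇ (λ x → ⌊ P? x ⌋) xs) f ≡ ∑ xs (λ x → ⟦ P? x ⟧ ℤ.* f x)
  ∑-filterᵇ P? []       f = refl
  ∑-filterᵇ P? (x ∷ xs) f with P? x
  ... | yes _ = cong₂ ℤ._+_ (sym (ℤP.*-identityˡ (f x))) (∑-filterᵇ P? xs f)
  ... | no _  = trans (∑-filterᵇ P? xs f) (sym (trans (cong (ℤ._+ rest) (ℤP.*-zeroˡ (f x))) (ℤP.+-identityˡ rest)))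
    where rest = ∑ xs (λ x → ⟦ P? x ⟧ ℤ.* f x)

∑-swap : {A B : Set} (xs : List A) (ys : List B) (f : A → B → ℤ) →
  ∑ xs (λ x → ∑ ys (f x)) ≡ ∑ ys (λ y → ∑ xs (λ x → f x y))
∑-swap []       ys f = sym (∑-0 ys (λ _ _ → refl))
∑-swap (x ∷ xs) ys f = trans (cong (λ t → ∑ ys (f x) ℤ.+ t) (∑-swap xs ys f))
  (sym (∑-+ ys (f x) (λ y → ∑ xs (λ x → f x y))))

-- The Möbius function

PrimeDivisor : ℕ → ℕ → Set
PrimeDivisor d q = Prime q × q ∣ d

SquareDivisible : ℕ → Set
SquareDivisible d = ∃ λ q → Prime q × q * q ∣ d

hasSquareᵇ : ℕ → Bool
hasSquareᵇ d = any (λ p → ⌊ (p * p) ∣? d ⌋) (primesUpTo d)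

ω : ℕ → ℕ
ω d = length (filterᵇ (λ p → ⌊ p ∣? d ⌋) (primesUpTo d))

∈-primesUpTo : ∀ d q → q ∈ primesUpTo d ⇔ (q ≤ d × Prime q)
∈-primesUpTo d q = mk⇔
  (λ q∈ → let q∈upTo , t = ∈-filter⁻ (λ p → T? ⌊ prime? p ⌋) {xs = upTo (suc d)} q∈ in ℕP.≤-pred (∈-upTo⁻ q∈upTo) , toWitness t)
  (λ { (q≤d , p-prime) → ∈-filter⁺ (λ p → T? ⌊ prime? p ⌋) (∈-upTo⁺ (s≤s q≤d)) (fromWitness p-prime) })

module _ (d : ℕ) .{{_ : NonZero d}} where
  open Equivalence

  card-primeDivisors : Card (PrimeDivisor d) (ω d)
  card-primeDivisors = filterᵇ (λ p → ⌊ p ∣? d ⌋) (primesUpTo d) ,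
    (UniqueP.filter⁺ (λ p → T? ⌊ p ∣? d ⌋) (UniqueP.filter⁺ (λ p → T? ⌊ prime? p ⌋) (UniqueP.upTo⁺ (suc d))) , λ q → mk⇔
      (λ q∈ → let q∈primes , t = ∈-filter⁻ (λ p → T? ⌊ p ∣? d ⌋) {xs = primesUpTo d} q∈ in
         proj₂ (to (∈-primesUpTo d q) q∈primes) , toWitness t)
      (λ { (p-prime , q∣d) → ∈-filter⁺ (λ p → T? ⌊ p ∣? d ⌋) (from (∈-primesUpTo d q) (∣⇒≤ q∣d , p-prime)) (fromWitness q∣d) })) ,
    refl

  T-hasSquareᵇ : T (hasSquareᵇ d) ⇔ SquareDivisible d
  T-hasSquareᵇ = mk⇔
    (λ t → let q , q∈ , t′ = to (T-any _ (primesUpTo d)) t in q , proj₂ (to (∈-primesUpTo d q) q∈) , toWitness t′)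
    (λ { (q , p-prime , q²∣d) → from (T-any _ (primesUpTo d))
       (q , from (∈-primesUpTo d q) (∣⇒≤ (∣-trans (m∣m*n q) q²∣d) , p-prime) , fromWitness q²∣d) })

T-ext : ∀ a b → (T a → T b) → (T b → T a) → a ≡ b
T-ext true  true  _ _ = refl
T-ext true  false f _ = ⊥-elim (f tt)
T-ext false true  _ g = ⊥-elim (g tt)
T-ext false false _ _ = refl

μ-square : ∀ d .{{_ : NonZero d}} → SquareDivisible d → μ d ≡ ℤ.+ 0
μ-square d sq with hasSquareᵇ d | Equivalence.from (T-hasSquareᵇ d) sq
... | true | _ = refl

module _ {p e : ℕ} (p-prime : Prime p) .{{_ : NonZero e}} (p∤e : ¬ (p ∣ e)) where
  open Equivalence

  private
    instance
      p≢0 : NonZero p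
      p≢0 = prime⇒nonZero p-prime
      pe≢0 : NonZero (p * e)
      pe≢0 = ℕP.m*n≢0 p e

  prime-∣-prime : ∀ {q} → Prime q → q ∣ p → q ≡ p
  prime-∣-prime primeq q∣p with prime⇒irreducible p-prime q∣p
  ... | inj₁ refl = contradiction primeq ¬prime[1]
  ... | inj₂ q≡p  = q≡p

  ω-prime* : ω (p * e) ≡ suc (ω e)
  ω-prime* with L , (uL , eL) , len ← card-primeDivisors e =
    card-unique (card-primeDivisors (p * e))
      (p ∷ L , (All.tabulate (λ { q∈ refl → p∤e (proj₂ (to (eL p) q∈)) }) ∷ uL , λ q → mk⇔ (into q) (outof q)) , cong suc len)
    where
    into : ∀ q → q ∈ p ∷ L → PrimeDivisor (p * e) q
    into q (here refl) = p-prime , m∣m*n e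
    into q (there q∈)  = proj₁ (to (eL q) q∈) , ∣n⇒∣m*n p (proj₂ (to (eL q) q∈))
    outof : ∀ q → PrimeDivisor (p * e) q → q ∈ p ∷ L
    outof q (primeq , q∣pe) with euclidsLemma p e primeq q∣pe
    ... | inj₁ q∣p = here (prime-∣-prime primeq q∣p)
    ... | inj₂ q∣e = there (from (eL q) (primeq , q∣e))

  -- The prime `q` cannot be `p`, since then `p` would divide `e`. So Euclid's lemma, used once for
  -- each factor `q`, moves both of them into `e`.
  squareDivisible-prime* : SquareDivisible (p * e) → SquareDivisible e
  squareDivisible-prime* (q , primeq , q²∣pe) = q , primeq , q²∣e
    where
    instance
      q≢0 : NonZero q
      q≢0 = prime⇒nonZero primeq
    q∤p : ¬ (q ∣ p)
    q∤p q∣p with refl ← prime-∣-prime primeq q∣p = p∤e (*-cancelˡ-∣ p q²∣pe)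
    q∣e : q ∣ e
    q∣e with euclidsLemma p e primeq (∣-trans (m∣m*n q) q²∣pe)
    ... | inj₁ q∣p = contradiction q∣p q∤p
    ... | inj₂ h   = h
    q²∣e : q * q ∣ e
    q²∣e with q∣e
    ... | divides k refl with euclidsLemma p k primeq (*-cancelʳ-∣ q (subst (q * q ∣_) (sym (ℕP.*-assoc p k q)) q²∣pe))
    ... | inj₁ q∣p = contradiction q∣p q∤p
    ... | inj₂ q∣k = *-monoˡ-∣ q q∣k

  hasSquareᵇ-prime* : hasSquareᵇ (p * e) ≡ hasSquareᵇ e
  hasSquareᵇ-prime* = T-ext _ _
    (λ t → from (T-hasSquareᵇ e) (squareDivisible-prime* (to (T-hasSquareᵇ (p * e)) t)))
    (λ t → let q , primeq , q²∣e = to (T-hasSquareᵇ e) t in from (T-hasSquareᵇ (p * e)) (q , primeq , ∣n⇒∣m*n p q²∣e))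

  μ-prime* : μ (p * e) ≡ ℤ.- μ e
  μ-prime* = begin
    μ (p * e)                                     ≡⟨ cong₂ value hasSquareᵇ-prime* ω-prime* ⟩
    value (hasSquareᵇ e) (suc (ω e))              ≡⟨ flip (hasSquareᵇ e) (ω e) ⟩
    ℤ.- μ e                                       ∎
    where
    open ≡-Reasoning
    value : Bool → ℕ → ℤ
    value b k = if b then ℤ.+ 0 else (if k % 2 ≡ᵇ 0 then ℤ.+ 1 else ℤ.-[1+ 0 ])
    flip : ∀ b k → value b (suc k) ≡ ℤ.- value b k
    flip true  k             = refl
    flip false zero          = refl
    flip false (suc zero)    = refl
    flip false (suc (suc k)) = flip false k

exists-prime-divisor : ∀ r → 2 ≤ r → ∃ λ p → Prime p × p ∣ r
exists-prime-divisor r 2≤r with factorise r {{ℕ.>-nonZero (ℕP.<-trans (s≤s z≤n) 2≤r)}}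
... | record { factors = [] ; isFactorisation = eq } = contradiction (subst (2 ≤_) eq 2≤r) λ { (s≤s ()) }
... | record { factors = p ∷ ps ; isFactorisation = eq ; factorsPrime = p-prime ∷ _ } =
  p , p-prime , subst (p ∣_) (sym eq) (m∣m*n _)

-- The substitution `d = p * e` is made by inserting the indicator of this equation and exchanging
-- the sums. The right side reaches arguments from `N` on, where `h` vanishes.
∑-multiples : ∀ p .{{_ : NonZero p}} N (h : ℕ → ℤ) → (∀ d → N ≤ d → h d ≡ ℤ.+ 0) →
  ∑ (upTo N) (λ d → ⟦ p ∣? d ⟧ ℤ.* h d) ≡ ∑ (upTo N) (λ e → h (p * e))
∑-multiples p N h vanish = begin
  ∑ (upTo N) (λ d → ⟦ p ∣? d ⟧ ℤ.* h d)                                        ≡⟨ ∑-cong (upTo N) (λ d d∈ → sym (column d (∈-upTo⁻ d∈))) ⟩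
  ∑ (upTo N) (λ d → ∑ (upTo N) (λ e → ⟦ d ℕP.≟ p * e ⟧ ℤ.* h d))               ≡⟨ ∑-swap (upTo N) (upTo N) _ ⟩
  ∑ (upTo N) (λ e → ∑ (upTo N) (λ d → ⟦ d ℕP.≟ p * e ⟧ ℤ.* h d))               ≡⟨ ∑-cong (upTo N) (λ e _ → row e) ⟩
  ∑ (upTo N) (λ e → h (p * e))                                                 ∎
  where
  open ≡-Reasoning
  term≡0 : ∀ d e → d ≢ p * e → ⟦ d ℕP.≟ p * e ⟧ ℤ.* h d ≡ ℤ.+ 0
  term≡0 d e neq = trans (cong (ℤ._* h d) (⟦⟧-no (d ℕP.≟ p * e) neq)) (ℤP.*-zeroˡ (h d))
  column : ∀ d → d < N → ∑ (upTo N) (λ e → ⟦ d ℕP.≟ p * e ⟧ ℤ.* h d) ≡ ⟦ p ∣? d ⟧ ℤ.* h d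
  column d d<N with p ∣? d
  ... | no p∤d = trans (∑-0 (upTo N) λ e _ → term≡0 d e λ { refl → p∤d (m∣m*n e) }) (sym (ℤP.*-zeroˡ (h d)))
  ... | yes (divides e refl) = trans
    (∑-single (upTo N) {x = e} (UniqueP.upTo⁺ N) (∈-upTo⁺ (ℕP.≤-<-trans (ℕP.m≤m*n e p) d<N))
      (λ e′ _ e′≢e → term≡0 (e * p) e′ λ eq → e′≢e (ℕP.*-cancelˡ-≡ e′ e p (trans (sym eq) (ℕP.*-comm e p)))))
    (cong (ℤ._* h (e * p)) (⟦⟧-yes (e * p ℕP.≟ p * e) (ℕP.*-comm e p)))
  row : ∀ e → ∑ (upTo N) (λ d → ⟦ d ℕP.≟ p * e ⟧ ℤ.* h d) ≡ h (p * e)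
  row e with ℕP.<-≤-connex (p * e) N
  ... | inj₁ pe<N = trans
    (∑-single (upTo N) {x = p * e} (UniqueP.upTo⁺ N) (∈-upTo⁺ pe<N) (λ d _ neq → term≡0 d e neq))
    (trans (cong (ℤ._* h (p * e)) (⟦⟧-yes (p * e ℕP.≟ p * e) refl)) (ℤP.*-identityˡ _))
  ... | inj₂ N≤pe = trans
    (∑-0 (upTo N) λ d d∈ → term≡0 d e λ { refl → ℕP.<⇒≱ (∈-upTo⁻ d∈) N≤pe })
    (sym (vanish (p * e) N≤pe))

-- With p a prime divisor of r, the divisors d and p d with p ∤ d cancel, and μ vanishes at
-- all the others.
∑-μ≡0 : ∀ r N → 2 ≤ r → r < N → ∑ (upTo N) (λ d → ⟦ d ∣? r ⟧ ℤ.* μ d) ≡ ℤ.+ 0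
∑-μ≡0 r N 2≤r r<N with p , p-prime , p∣r ← exists-prime-divisor r 2≤r = begin
  ∑ (upTo N) h                                                                          ≡⟨ ∑-cong (upTo N) (λ d _ → split d) ⟩
  ∑ (upTo N) (λ d → ⟦ ¬? (p ∣? d) ⟧ ℤ.* h d ℤ.+ ⟦ p ∣? d ⟧ ℤ.* h d)                       ≡⟨ ∑-+ (upTo N) _ _ ⟩
  ∑ (upTo N) (λ d → ⟦ ¬? (p ∣? d) ⟧ ℤ.* h d) ℤ.+ ∑ (upTo N) (λ d → ⟦ p ∣? d ⟧ ℤ.* h d)     ≡⟨ cong (λ t → ∑ (upTo N) (λ d → ⟦ ¬? (p ∣? d) ⟧ ℤ.* h d) ℤ.+ t) (∑-multiples p N h vanish) ⟩
  ∑ (upTo N) (λ d → ⟦ ¬? (p ∣? d) ⟧ ℤ.* h d) ℤ.+ ∑ (upTo N) (λ d → h (p * d))             ≡⟨ sym (∑-+ (upTo N) _ _) ⟩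
  ∑ (upTo N) (λ d → ⟦ ¬? (p ∣? d) ⟧ ℤ.* h d ℤ.+ h (p * d))                               ≡⟨ ∑-0 (upTo N) (λ d _ → cancel d) ⟩
  ℤ.+ 0                                                                                 ∎
  where
  open ≡-Reasoning
  h : ℕ → ℤ
  h d = ⟦ d ∣? r ⟧ ℤ.* μ d
  instance
    r≢0 : NonZero r
    r≢0 = ℕ.>-nonZero (ℕP.<-trans (s≤s z≤n) 2≤r)
    p≢0 : NonZero p
    p≢0 = prime⇒nonZero p-prime
  h≡0 : ∀ d → ¬ (d ∣ r) → h d ≡ ℤ.+ 0
  h≡0 d d∤r = trans (cong (ℤ._* μ d) (⟦⟧-no (d ∣? r) d∤r)) (ℤP.*-zeroˡ (μ d))
  vanish : ∀ d → N ≤ d → h d ≡ ℤ.+ 0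
  vanish d N≤d = h≡0 d λ d∣r → ℕP.<⇒≱ r<N (ℕP.≤-trans N≤d (∣⇒≤ d∣r))
  split : ∀ d → h d ≡ ⟦ ¬? (p ∣? d) ⟧ ℤ.* h d ℤ.+ ⟦ p ∣? d ⟧ ℤ.* h d
  split d with p ∣? d
  ... | yes _ = sym (trans (cong₂ ℤ._+_ (ℤP.*-zeroˡ (h d)) (ℤP.*-identityˡ (h d))) (ℤP.+-identityˡ (h d)))
  ... | no _  = sym (trans (cong₂ ℤ._+_ (ℤP.*-identityˡ (h d)) (ℤP.*-zeroˡ (h d))) (ℤP.+-identityʳ (h d)))
  divides⇒nonZero : ∀ {d} → d ∣ r → NonZero d
  divides⇒nonZero {zero}  0∣r = contradiction (0∣⇒≡0 0∣r) (ℕ.≢-nonZero⁻¹ r)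
  divides⇒nonZero {suc _} _   = _
  p*-∣ : ∀ {d} → ¬ (p ∣ d) → d ∣ r → p * d ∣ r
  p*-∣ {d} p∤d (divides k eq) with euclidsLemma k d p-prime (subst (p ∣_) eq p∣r)
  ... | inj₁ p∣k = subst (p * d ∣_) (sym eq) (*-monoˡ-∣ d p∣k)
  ... | inj₂ p∣d = contradiction p∣d p∤d
  h-multiple : ∀ d → p ∣ d → h (p * d) ≡ ℤ.+ 0
  h-multiple d p∣d with p * d ∣? r
  ... | no _    = ℤP.*-zeroˡ (μ (p * d))
  ... | yes pd∣r = trans (ℤP.*-identityˡ _) (μ-square (p * d) {{divides⇒nonZero pd∣r}} (p , p-prime , *-monoʳ-∣ p p∣d))
  cancel : ∀ d → ⟦ ¬? (p ∣? d) ⟧ ℤ.* h d ℤ.+ h (p * d) ≡ ℤ.+ 0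
  cancel d with p ∣? d
  ... | yes p∣d = cong₂ ℤ._+_ (ℤP.*-zeroˡ (h d)) (h-multiple d p∣d)
  ... | no p∤d with d ∣? r
  ... | no d∤r = cong₂ ℤ._+_ (trans (ℤP.*-identityˡ _) (ℤP.*-zeroˡ (μ d))) (h≡0 (p * d) λ pd∣r → d∤r (∣-trans (n∣m*n p) pd∣r))
  ... | yes d∣r = begin
    ℤ.+ 1 ℤ.* (ℤ.+ 1 ℤ.* μ d) ℤ.+ h (p * d)   ≡⟨ cong₂ ℤ._+_ (trans (ℤP.*-identityˡ (ℤ.+ 1 ℤ.* μ d)) (ℤP.*-identityˡ (μ d))) h-pd ⟩
    μ d ℤ.+ ℤ.- μ d                            ≡⟨ ℤP.+-inverseʳ (μ d) ⟩
    ℤ.+ 0                                      ∎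
    where
    h-pd : h (p * d) ≡ ℤ.- μ d
    h-pd = trans (cong (ℤ._* μ (p * d)) (⟦⟧-yes (p * d ∣? r) (p*-∣ p∤d d∣r)))
      (trans (ℤP.*-identityˡ _) (μ-prime* p-prime {{divides⇒nonZero d∣r}} p∤d))

∑-μ : ∀ r N .{{_ : NonZero r}} → r ≤ N → ∑ (upTo N) (λ e → ⟦ suc e ∣? r ⟧ ℤ.* μ (suc e)) ≡ ⟦ r ℕP.≟ 1 ⟧
∑-μ r N r≤N with r ℕP.≟ 1
... | yes refl = ∑-single (upTo N) {x = 0} (UniqueP.upTo⁺ N) (∈-upTo⁺ r≤N)
  (λ e _ e≢0 → trans (cong (ℤ._* μ (suc e)) (⟦⟧-no (suc e ∣? 1) λ se∣1 → e≢0 (ℕP.suc-injective (∣1⇒≡1 se∣1)))) (ℤP.*-zeroˡ (μ (suc e))))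
... | no r≢1 = begin
  ∑ (upTo N) (h ∘ suc)              ≡⟨ cong (List.foldr ℤ._+_ (ℤ.+ 0)) (trans (ListP.map-upTo (h ∘ suc) N) (sym (ListP.map-applyUpTo suc h N))) ⟩
  ∑ (List.applyUpTo suc N) h        ≡⟨ sym (ℤP.+-identityˡ _) ⟩
  -- The term at 0 may be added, as 0 does not divide the nonzero `r`; this passes from the indices
  -- `suc e` to all of `upTo (suc N)`.
  ℤ.+ 0 ℤ.+ ∑ (List.applyUpTo suc N) h ≡⟨ cong (ℤ._+ ∑ (List.applyUpTo suc N) h) (sym h0) ⟩
  ∑ (upTo (suc N)) h                ≡⟨ ∑-μ≡0 r (suc N) (ℕP.≤∧≢⇒< (ℕ.>-nonZero⁻¹ r) (λ eq → r≢1 (sym eq))) (s≤s r≤N) ⟩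
  ℤ.+ 0                             ∎
  where
  open ≡-Reasoning
  h : ℕ → ℤ
  h d = ⟦ d ∣? r ⟧ ℤ.* μ d
  h0 : h 0 ≡ ℤ.+ 0
  h0 = trans (cong (ℤ._* μ 0) (⟦⟧-no (0 ∣? r) λ 0∣r → ℕ.≢-nonZero⁻¹ r (0∣⇒≡0 0∣r))) (ℤP.*-zeroˡ (μ 0))

-- Counting primitive words

-- Descent on the period: a period `p` that `n` does not divide yields the strictly smaller period
-- gcd of `p` and `n`. By `prim-below` only `p < n` has to be searched.
primitive-root : ∀ n .{{_ : NonZero n}} {s : ℕ → Fin 2} → Period n s → ∃ λ p → NonZero p × Prim p s
primitive-root n {s} per = <-rec Goal step n (ℕ.>-nonZero⁻¹ n) per
  where
  Goal : ℕ → Set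
  Goal n = 0 < n → Period n s → ∃ λ p → NonZero p × Prim p s
  step : ∀ n → (∀ {m} → m < n → Goal m) → Goal n
  step n rec n>0 per = conclude (ℕP.anyUpTo? (λ p → period? per p ×-dec ¬? (n ∣? p)) n)
    where
    instance
      n≢0 : NonZero n
      n≢0 = ℕ.>-nonZero n>0
    conclude : Dec _ → ∃ λ p → NonZero p × Prim p s
    conclude (no none) = n , n≢0 , prim-below per λ p p<n perp →
      decidable-stable (n ∣? p) λ n∤p → none (p , p<n , perp , n∤p)
    conclude (yes (p , _ , perp , n∤p)) with Bézout.lemma p n
    ... | Bézout.result d gcd _ with d∣p , d∣n ← GCD.GCD.commonDivisor gcd =
      rec (ℕP.≤∧≢⇒< (∣⇒≤ d∣n) (λ { refl → n∤p d∣p }))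
        (ℕP.n≢0⇒n>0 λ { refl → ℕ.≢-nonZero⁻¹ n (0∣⇒≡0 d∣n) })
        (period-gcd gcd perp per)

-- Such a word is determined by its first `c` letters, which are arbitrary.
card-period : ∀ n c .{{_ : NonZero n}} .{{_ : NonZero c}} → c ∣ n →
  Card (λ (w : Vec (Fin 2) n) → Period c (cyc w)) (2 ^ c)
card-period n c c∣n = subst (Card _) (length-allVecs 2 c)
  (card-bijection repeat pres inj surj (allVecs 2 c , allVecs-enumerates 2 c , refl))
  where
  repeat : Vec (Fin 2) c → Vec (Fin 2) n
  repeat v = word-vec (cyc v)
  cyc-repeat : ∀ v i → cyc (repeat v) i ≡ cyc v i
  cyc-repeat v = cyc-tabulate (cyc v) (period-∣ c∣n (cyc-period v))
  pres : ∀ v → ⊤ → Period c (cyc (repeat v))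
  pres v _ i = trans (cyc-repeat v (c + i)) (trans (cyc-period v i) (sym (cyc-repeat v i)))
  inj : ∀ v w → ⊤ → ⊤ → repeat v ≡ repeat w → v ≡ w
  inj v w _ _ eq = cyc-injective v w λ i →
    trans (sym (cyc-repeat v i)) (trans (cong (λ u → cyc u i) eq) (cyc-repeat w i))
  surj : ∀ (w : Vec (Fin 2) n) → Period c (cyc w) → ∃ λ v → ⊤ × repeat v ≡ w
  surj w per = word-vec (cyc w) , tt ,
    cyc-injective _ w λ i → trans (cyc-repeat (word-vec (cyc w)) i) (cyc-tabulate {n = c} (cyc w) per i)

module _ (n : ℕ) .{{_ : NonZero n}} where

  hasPeriod : Vec (Fin 2) n → ℕ → ℤ
  hasPeriod w c = ⟦ period? (cyc-period w) c ⟧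

  ∑-hasPeriod : ∀ c .{{_ : NonZero c}} → c ∣ n → ∑ (allVecs 2 n) (λ w → hasPeriod w c) ≡ ℤ.+ (2 ^ c)
  ∑-hasPeriod c c∣n = trans (sym (length-filter≡∑ (λ w → period? (cyc-period w) c) (allVecs 2 n)))
    (cong ℤ.+_ (card-unique (card-filter (λ w → period? (cyc-period w) c) (allVecs-enumerates 2 n)) (card-period n c c∣n)))

  -- If w has primitive root of length p and n = r p, then w has period n / d iff d ∣ r.
  ∑-μ-periods : ∀ w → ∑ (upTo n) (λ e → ⟦ suc e ∣? n ⟧ ℤ.* (μ (suc e) ℤ.* hasPeriod w (n / suc e)))
                      ≡ ⟦ prim? (cyc-period w) ⟧
  ∑-μ-periods w with p , p≢0 , perp , prim ← primitive-root n (cyc-period w) =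
    conclude p {{p≢0}} perp prim (prim n (cyc-period w))
    where
    conclude : ∀ p .{{_ : NonZero p}} → Period p (cyc w) → (∀ q → Period q (cyc w) → p ∣ q) → p ∣ n →
      ∑ (upTo n) (λ e → ⟦ suc e ∣? n ⟧ ℤ.* (μ (suc e) ℤ.* hasPeriod w (n / suc e))) ≡ ⟦ prim? (cyc-period w) ⟧
    conclude p perp prim (divides r n≡) = begin
      ∑ (upTo n) (λ e → ⟦ suc e ∣? n ⟧ ℤ.* (μ (suc e) ℤ.* hasPeriod w (n / suc e)))   ≡⟨ ∑-cong (upTo n) (λ e _ → term e) ⟩
      ∑ (upTo n) (λ e → ⟦ suc e ∣? r ⟧ ℤ.* μ (suc e))                                  ≡⟨ ∑-μ r n (subst (r ≤_) (sym n≡) (ℕP.m≤m*n r p)) ⟩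
      ⟦ r ℕP.≟ 1 ⟧                                                                     ≡⟨ ⟦⟧-cong (r ℕP.≟ 1) (prim? (cyc-period w)) r≡1⇒prim prim⇒r≡1 ⟩
      ⟦ prim? (cyc-period w) ⟧                                                         ∎
      where
      open ≡-Reasoning
      instance
        r≢0 : NonZero r
        r≢0 = ℕP.m*n≢0⇒m≢0 r {{subst NonZero n≡ it}}
      r≡1⇒prim : r ≡ 1 → Prim n (cyc w)
      r≡1⇒prim refl = cyc-period w , λ q perq → subst (_∣ q) (sym (trans n≡ (ℕP.+-identityʳ p))) (prim q perq)
      prim⇒r≡1 : Prim n (cyc w) → r ≡ 1
      prim⇒r≡1 (_ , prim′) = ℕP.*-cancelʳ-≡ r 1 p
        (trans (sym n≡) (trans (∣-antisym (prim′ p perp) (divides r n≡)) (sym (ℕP.+-identityʳ p))))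
      to-r : ∀ d .{{_ : NonZero d}} → d ∣ n → Period (n / d) (cyc w) → d ∣ r
      to-r d d∣n per with divides k eq ← prim (n / d) per = divides k (ℕP.*-cancelʳ-≡ r (k * d) p (begin
        r * p          ≡⟨ sym n≡ ⟩
        n              ≡⟨ sym (m/n*n≡m d∣n) ⟩
        n / d * d      ≡⟨ cong (_* d) eq ⟩
        k * p * d      ≡⟨ ℕP.*-assoc k p d ⟩
        k * (p * d)    ≡⟨ cong (k *_) (ℕP.*-comm p d) ⟩
        k * (d * p)    ≡⟨ sym (ℕP.*-assoc k d p) ⟩
        k * d * p      ∎))
      d∣n′ : ∀ {d} → d ∣ r → d ∣ n
      d∣n′ d∣r = subst (_ ∣_) (sym n≡) (∣m⇒∣m*n p d∣r)
      from-r : ∀ d .{{_ : NonZero d}} → d ∣ r → Period (n / d) (cyc w)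
      from-r d d∣r with divides k refl ← d∣r = period-∣ (divides k (begin
        n / d              ≡⟨ cong (_/ d) n≡ ⟩
        k * d * p / d      ≡⟨ cong (_/ d) (trans (ℕP.*-assoc k d p) (trans (cong (k *_) (ℕP.*-comm d p)) (sym (ℕP.*-assoc k p d)))) ⟩
        k * p * d / d      ≡⟨ m*n/n≡m (k * p) d ⟩
        k * p              ∎)) perp
      term : ∀ e → ⟦ suc e ∣? n ⟧ ℤ.* (μ (suc e) ℤ.* hasPeriod w (n / suc e)) ≡ ⟦ suc e ∣? r ⟧ ℤ.* μ (suc e)
      term e with suc e ∣? r
      ... | yes d∣r = begin
        ⟦ suc e ∣? n ⟧ ℤ.* (μ (suc e) ℤ.* hasPeriod w (n / suc e))
          ≡⟨ cong₂ (λ a b → a ℤ.* (μ (suc e) ℤ.* b)) (⟦⟧-yes (suc e ∣? n) (d∣n′ d∣r)) (⟦⟧-yes (period? (cyc-period w) (n / suc e)) (from-r (suc e) d∣r)) ⟩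
        ℤ.+ 1 ℤ.* (μ (suc e) ℤ.* ℤ.+ 1)
          ≡⟨ cong (ℤ.+ 1 ℤ.*_) (ℤP.*-identityʳ (μ (suc e))) ⟩
        ℤ.+ 1 ℤ.* μ (suc e) ∎
      ... | no d∤r with suc e ∣? n
      ... | no _    = trans (ℤP.*-zeroˡ (μ (suc e) ℤ.* hasPeriod w (n / suc e))) (sym (ℤP.*-zeroˡ (μ (suc e))))
      ... | yes d∣n = begin
        ℤ.+ 1 ℤ.* (μ (suc e) ℤ.* hasPeriod w (n / suc e))
          ≡⟨ cong (λ b → ℤ.+ 1 ℤ.* (μ (suc e) ℤ.* b)) (⟦⟧-no (period? (cyc-period w) (n / suc e)) (λ per → d∤r (to-r (suc e) d∣n per))) ⟩
        ℤ.+ 1 ℤ.* (μ (suc e) ℤ.* ℤ.+ 0)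
          ≡⟨ trans (ℤP.*-identityˡ _) (ℤP.*-zeroʳ (μ (suc e))) ⟩
        ℤ.+ 0
          ≡⟨ sym (ℤP.*-zeroˡ (μ (suc e))) ⟩
        ℤ.+ 0 ℤ.* μ (suc e) ∎

  -- Möbius inversion word by word: the indicator of primitivity is expanded over the divisors `d`
  -- of `n`, and exchanging the sums leaves, for each `d`, the count of words with period `n / d`.
  -- No recursion over smaller lengths is involved.
  primCount≡nL₂ : ℤ.+ primCount n ≡ nL₂ n
  primCount≡nL₂ = begin
    ℤ.+ primCount n
      ≡⟨ length-filter≡∑ (λ w → prim? (cyc-period w)) (allVecs 2 n) ⟩
    ∑ (allVecs 2 n) (λ w → ⟦ prim? (cyc-period w) ⟧)
      ≡⟨ ∑-cong (allVecs 2 n) (λ w _ → sym (∑-μ-periods w)) ⟩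
    ∑ (allVecs 2 n) (λ w → ∑ (upTo n) (λ e → ⟦ suc e ∣? n ⟧ ℤ.* (μ (suc e) ℤ.* hasPeriod w (n / suc e))))
      ≡⟨ ∑-swap (allVecs 2 n) (upTo n) _ ⟩
    ∑ (upTo n) (λ e → ∑ (allVecs 2 n) (λ w → ⟦ suc e ∣? n ⟧ ℤ.* (μ (suc e) ℤ.* hasPeriod w (n / suc e))))
      ≡⟨ ∑-cong (upTo n) (λ e _ → row e) ⟩
    ∑ (upTo n) (λ e → ⟦ suc e ∣? n ⟧ ℤ.* (μ (suc e) ℤ.* ℤ.+ (2 ^ (n / suc e))))
      ≡⟨ sym (∑-filterᵇ (λ e → suc e ∣? n) (upTo n) _) ⟩
    nL₂ n ∎
    where
    open ≡-Reasoning
    row : ∀ e → ∑ (allVecs 2 n) (λ w → ⟦ suc e ∣? n ⟧ ℤ.* (μ (suc e) ℤ.* hasPeriod w (n / suc e)))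
              ≡ ⟦ suc e ∣? n ⟧ ℤ.* (μ (suc e) ℤ.* ℤ.+ (2 ^ (n / suc e)))
    row e = trans (∑-*ˡ (allVecs 2 n) ⟦ suc e ∣? n ⟧ _)
      (trans (cong (⟦ suc e ∣? n ⟧ ℤ.*_) (∑-*ˡ (allVecs 2 n) (μ (suc e)) (λ w → hasPeriod w (n / suc e)))) (count (suc e ∣? n)))
      where
      count : (D : Dec (suc e ∣ n)) → ⟦ D ⟧ ℤ.* (μ (suc e) ℤ.* ∑ (allVecs 2 n) (λ w → hasPeriod w (n / suc e)))
                                    ≡ ⟦ D ⟧ ℤ.* (μ (suc e) ℤ.* ℤ.+ (2 ^ (n / suc e)))
      count (no _)    = trans (ℤP.*-zeroˡ (μ (suc e) ℤ.* ∑ (allVecs 2 n) (λ w → hasPeriod w (n / suc e)))) (sym (ℤP.*-zeroˡ (μ (suc e) ℤ.* ℤ.+ (2 ^ (n / suc e)))))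
      count (yes d∣n) = cong (λ t → ℤ.+ 1 ℤ.* (μ (suc e) ℤ.* t))
        (∑-hasPeriod (n / suc e) {{n/d≢0}} (divides (suc e) (trans (sym (m/n*n≡m d∣n)) (ℕP.*-comm (n / suc e) (suc e)))))
        where
        n/d≢0 : NonZero (n / suc e)
        n/d≢0 = ℕP.m*n≢0⇒m≢0 (n / suc e) {{subst NonZero (sym (m/n*n≡m d∣n)) it}}

-- Combining the counts

-- The case `n = 2` is excluded, so the quotient by 4 is positive. Thus `n / 2` is not only odd but
-- at least 3, the bound under which orderings of that length are counted.
mod4≡2 : ∀ n → 3 ≤ n → n % 4 ≡ 2 → ∃ λ h → n / 2 ≡ 3 + h * 2 × n ≡ n / 2 * 2
mod4≡2 n 3≤n n%4≡2 with n / 4 | m≡m%n+[m/n]*n n 4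
... | zero  | eq = contradiction (subst (3 ≤_) (trans eq (cong (_+ 0) n%4≡2)) 3≤n) λ { (s≤s (s≤s ())) }
... | suc h | eq = h , half , trans n≡ (cong (_* 2) (sym half))
  where
  n≡ : n ≡ (3 + h * 2) * 2
  n≡ = trans eq (cong₂ _+_ n%4≡2 (cong (4 +_) (sym (ℕP.*-assoc h 2 2))))
  half : n / 2 ≡ 3 + h * 2
  half = trans (cong (_/ 2) n≡) (m*n/n≡m (3 + h * 2) 2)

-- Primitive words of length `m` occur twice with weight 2: as squares among the orderings of length
-- `n`, and in `n * C′ m 2`, which is twice `m * C′ m 2`. The two contributions cancel.
cycles-primitive : ∀ n m h .{{_ : NonZero n}} → n ≡ m * 2 → m ≡ 3 + h * 2 →
  ℤ.+ n ℤ.* (ℤ.+ C′ n 2 ℤ.- ℤ.+ C′ m 2) ≡ ℤ.+ primCount n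
cycles-primitive n m@(suc _) h n≡ m≡ = begin
  ℤ.+ n ℤ.* (ℤ.+ C′ n 2 ℤ.- ℤ.+ C′ m 2)                  ≡⟨ ℤP.*-distribˡ-+ (ℤ.+ n) (ℤ.+ C′ n 2) (ℤ.- ℤ.+ C′ m 2) ⟩
  ℤ.+ n ℤ.* ℤ.+ C′ n 2 ℤ.+ ℤ.+ n ℤ.* (ℤ.- ℤ.+ C′ m 2)    ≡⟨ cong (λ t → ℤ.+ n ℤ.* ℤ.+ C′ n 2 ℤ.+ t) (sym (ℤP.neg-distribʳ-* (ℤ.+ n) (ℤ.+ C′ m 2))) ⟩
  ℤ.+ n ℤ.* ℤ.+ C′ n 2 ℤ.- ℤ.+ n ℤ.* ℤ.+ C′ m 2           ≡⟨ cong₂ ℤ._-_ (sym (ℤP.pos-* n (C′ n 2))) (sym (ℤP.pos-* n (C′ m 2))) ⟩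
  ℤ.+ (n * C′ n 2) ℤ.- ℤ.+ (n * C′ m 2)                   ≡⟨ cong₂ (λ a b → ℤ.+ a ℤ.- ℤ.+ b) cycles-n cycles-m ⟩
  ℤ.+ (primCount n + primCount m * 2) ℤ.- ℤ.+ (primCount m * 2)
    ≡⟨ cong (ℤ._- ℤ.+ (primCount m * 2)) (ℤP.pos-+ (primCount n) (primCount m * 2)) ⟩
  ℤ.+ primCount n ℤ.+ ℤ.+ (primCount m * 2) ℤ.- ℤ.+ (primCount m * 2)
    ≡⟨ ℤP.+-assoc (ℤ.+ primCount n) (ℤ.+ (primCount m * 2)) (ℤ.- ℤ.+ (primCount m * 2)) ⟩
  ℤ.+ primCount n ℤ.+ (ℤ.+ (primCount m * 2) ℤ.- ℤ.+ (primCount m * 2))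
    ≡⟨ cong (λ t → ℤ.+ primCount n ℤ.+ t) (ℤP.+-inverseʳ (ℤ.+ (primCount m * 2))) ⟩
  ℤ.+ primCount n ℤ.+ ℤ.+ 0                               ≡⟨ ℤP.+-identityʳ (ℤ.+ primCount n) ⟩
  ℤ.+ primCount n                                         ∎
  where
  open ≡-Reasoning
  3≤m : 3 ≤ m
  3≤m = subst (3 ≤_) (sym m≡) (ℕP.m≤m+n 3 (h * 2))
  3≤n : 3 ≤ n
  3≤n = ℕP.≤-trans 3≤m (subst (m ≤_) (sym n≡) (ℕP.m≤m*n m 2))
  cycles-n : n * C′ n 2 ≡ primCount n + primCount m * 2
  cycles-n = trans (ℕP.*-comm n (C′ n 2))
    (card-unique (card-ordering n 3≤n) (card-ordering-even n m (suc h) 3≤n n≡ m≡))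
  cycles-m : n * C′ m 2 ≡ primCount m * 2
  cycles-m = begin
    n * C′ m 2        ≡⟨ cong (_* C′ m 2) (trans n≡ (ℕP.*-comm m 2)) ⟩
    2 * m * C′ m 2    ≡⟨ ℕP.*-assoc 2 m (C′ m 2) ⟩
    2 * (m * C′ m 2)  ≡⟨ cong (2 *_) (trans (ℕP.*-comm m (C′ m 2)) (card-unique (card-ordering m 3≤m) (card-ordering-odd m (suc h) 3≤m m≡))) ⟩
    2 * primCount m   ≡⟨ ℕP.*-comm 2 (primCount m) ⟩
    primCount m * 2   ∎

theorem3p14 : (n : ℕ) → 3 ≤ n → n % 4 ≡ 2 →
    Σ (List (Vec (Fin n) n)) (λ L →
    Enumerates (InP (reverseSigns 2) n) L ×
    (ℤ.+ length L ≡ ℤ.+ n ℤ.* (ℤ.+ C′ n 2 ℤ.- ℤ.+ C′ (n / 2) 2)) ×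
    (ℤ.+ n ℤ.* (ℤ.+ C′ n 2 ℤ.- ℤ.+ C′ (n / 2) 2) ≡ nL₂ n))
theorem3p14 n@(suc _) 3≤n n%4≡2 =
  let L , enumerates , len = card-InP n 3≤n
      h , m≡ , n≡ = mod4≡2 n 3≤n n%4≡2
      cycles≡ = cycles-primitive n (n / 2) h n≡ m≡
  in L , enumerates , trans (cong ℤ.+_ len) (sym cycles≡) , trans cycles≡ (primCount≡nL₂ n)
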